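{- Let $f:D\to\{0,1\}$, $D\subseteq\{0,1\}^n$, be an $n$-bit partial Boolean function that depends on $n$ bits. Then $f$ can be computed exactly by a quantum 1-query algorithm if and only if either $n=1$, $D=\{0,1\}$ and $f(x)=x_1$ or $f(x)=1\oplus x_1$; or $n=2$, $D\subseteq\{0,1\}^2$ with $|D|\in\{3,4\}$, and $f(x)=x_1\oplus x_2$ or $f(x)=1\oplus x_1\oplus x_2$ for all $x\in D$.
   Context: An $n$-bit partial Boolean function is a map $f:D\to\{0,1\}$ with $D\subseteq\{0,1\}^n$. A multilinear polynomial $p$ in $x_1,\dots,x_n$ represents $f$ if $p(x)=f(x)$ for all $x\in D$. $f$ depends on $k$ bits if $k$ is the minimum, over all multilinear polynomials representing $f$, of the number of variables occurring in the polynomial. A quantum 1-query algorithm works in a finite-dimensional Hilbert space with orthonormal basis $\{|i,j'\rangle\}$, $i\in\{0,1,\dots,n\}$, $j'$ in a finite set; for input $x$ the oracle is $O_x|i,j'\rangle=(-1)^{x_i}|i,j'\rangle$ for $i\ge1$ and $O_x|0,j'\rangle=|0,j'\rangle$. The algorithm applies input-independent unitaries $U_0$, then $O_x$, then $U_1$ to an initial state $|\psi_0\rangle$ and performs a projective measurement with outcomes in $\{0,1\}$; it computes $f$ exactly if for every $x\in D$ the outcome is $f(x)$ with probability 1. -}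

module Defs where

open import Algebra.Bundles using (RawRing)
import Algebra.Definitions.RawMonoid as RawMonoidSum
open import Data.Bool.Base using (Bool; true; false; T; not; _∧_; _xor_; if_then_else_)
open import Data.Fin.Base using (Fin; zero; suc)
import Data.Fin.Properties as Fin
open import Data.Fin.Subset using (Subset; _∈_; ∣_∣)
open import Data.List.Base as List using (List; []; _∷_; _++_)
open import Data.Nat.Base as ℕ using (ℕ; zero; suc; _⊔_)
import Data.Nat.Properties as ℕ
open import Data.Product.Base using (∃-syntax; Σ-syntax; _×_; _,_; proj₁; proj₂)
open import Data.Rational.Base as ℚ using (ℚ; 0ℚ; 1ℚ; ½)
import Data.Rational.Properties as ℚ
open import Data.Rational.Solver using (module +-*-Solver)
open import Data.Sum.Base using (_⊎_)
open import Data.Vec.Base as Vec using (Vec; []; _∷_; lookup)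
open import Function.Bundles using (_⇔_)
open import Level using (0ℓ)
open import Relation.Binary.PropositionalEquality
  using (_≡_; refl; sym; trans; cong; subst)
open import Relation.Nullary using (¬_; does)

-- Real numbers: Cauchy sequences of rationals, with pointwise operations
-- and the setoid equality "the difference tends to 0".
IsCauchy : (ℕ → ℚ) → Set
IsCauchy s = ∀ ε → 0ℚ ℚ.< ε →
  ∃[ N ] (∀ m n → N ℕ.≤ m → N ℕ.≤ n → ℚ.∣ s m ℚ.- s n ∣ ℚ.< ε)

record ℝ : Set where
  constructor mkℝ
  field
    seq    : ℕ → ℚ
    cauchy : IsCauchy seq

open ℝ public

infix 4 _≈ᴿ_

record _≈ᴿ_ (x y : ℝ) : Set where
  constructor mk≈
  field
    close : ∀ ε → 0ℚ ℚ.< ε →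
      ∃[ N ] (∀ n → N ℕ.≤ n → ℚ.∣ seq x n ℚ.- seq y n ∣ ℚ.< ε)

open _≈ᴿ_ public

private
  open ℚ.≤-Reasoning
  open +-*-Solver

  half-pos : ∀ ε → 0ℚ ℚ.< ε → 0ℚ ℚ.< ½ ℚ.* ε
  half-pos ε 0<ε = ℚ.*-monoʳ-<-pos ½ 0<ε

  half+half : ∀ ε → ½ ℚ.* ε ℚ.+ ½ ℚ.* ε ≡ ε
  half+half ε = trans (sym (ℚ.*-distribʳ-+ ε ½ ½)) (ℚ.*-identityˡ ε)

  const-cauchy : ∀ q → IsCauchy (λ _ → q)
  const-cauchy q ε 0<ε = 0 , λ _ _ _ _ →
    subst (λ r → ℚ.∣ r ∣ ℚ.< ε) (sym (ℚ.+-inverseʳ q)) 0<ε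

  +-cauchy : ∀ {s t} → IsCauchy s → IsCauchy t → IsCauchy (λ n → s n ℚ.+ t n)
  +-cauchy {s} {t} cs ct ε 0<ε =
    let N₁ , h₁ = cs (½ ℚ.* ε) (half-pos ε 0<ε)
        N₂ , h₂ = ct (½ ℚ.* ε) (half-pos ε 0<ε)
    in N₁ ⊔ N₂ , λ m n N≤m N≤n → begin-strict
      ℚ.∣ (s m ℚ.+ t m) ℚ.- (s n ℚ.+ t n) ∣
        ≡⟨ cong ℚ.∣_∣ (solve 4 (λ a b c d →
             (a :+ b) :- (c :+ d) := (a :- c) :+ (b :- d)) refl
             (s m) (t m) (s n) (t n)) ⟩
      ℚ.∣ (s m ℚ.- s n) ℚ.+ (t m ℚ.- t n) ∣
        ≤⟨ ℚ.∣p+q∣≤∣p∣+∣q∣ (s m ℚ.- s n) (t m ℚ.- t n) ⟩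
      ℚ.∣ s m ℚ.- s n ∣ ℚ.+ ℚ.∣ t m ℚ.- t n ∣
        <⟨ ℚ.+-mono-< (h₁ m n (ℕ.m⊔n≤o⇒m≤o N₁ N₂ N≤m) (ℕ.m⊔n≤o⇒m≤o N₁ N₂ N≤n))
                      (h₂ m n (ℕ.m⊔n≤o⇒n≤o N₁ N₂ N≤m) (ℕ.m⊔n≤o⇒n≤o N₁ N₂ N≤n)) ⟩
      ½ ℚ.* ε ℚ.+ ½ ℚ.* ε
        ≡⟨ half+half ε ⟩
      ε ∎

  neg-cauchy : ∀ {s} → IsCauchy s → IsCauchy (λ n → ℚ.- s n)
  neg-cauchy {s} cs ε 0<ε =
    let N , h = cs ε 0<ε
    in N , λ m n N≤m N≤n → begin-strict
      ℚ.∣ (ℚ.- s m) ℚ.- (ℚ.- s n) ∣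
        ≡⟨ cong ℚ.∣_∣ (solve 2 (λ a b → (:- a) :- (:- b) := :- (a :- b)) refl (s m) (s n)) ⟩
      ℚ.∣ ℚ.- (s m ℚ.- s n) ∣
        ≡⟨ ℚ.∣-p∣≡∣p∣ (s m ℚ.- s n) ⟩
      ℚ.∣ s m ℚ.- s n ∣
        <⟨ h m n N≤m N≤n ⟩
      ε ∎

  eventual-bound : ∀ {s} → IsCauchy s →
    Σ[ B ∈ ℚ ] (0ℚ ℚ.< B × ∃[ N ] (∀ n → N ℕ.≤ n → ℚ.∣ s n ∣ ℚ.≤ B))
  eventual-bound {s} cs =
    let N , h = cs 1ℚ (ℚ.positive⁻¹ 1ℚ)
    in ℚ.∣ s N ∣ ℚ.+ 1ℚ
     , ℚ.+-mono-≤-< (ℚ.0≤∣p∣ (s N)) (ℚ.positive⁻¹ 1ℚ)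
     , N
     , λ n N≤n → begin
         ℚ.∣ s n ∣
           ≡⟨ cong ℚ.∣_∣ (solve 2 (λ a b → a := b :+ (a :- b)) refl (s n) (s N)) ⟩
         ℚ.∣ s N ℚ.+ (s n ℚ.- s N) ∣
           ≤⟨ ℚ.∣p+q∣≤∣p∣+∣q∣ (s N) (s n ℚ.- s N) ⟩
         ℚ.∣ s N ∣ ℚ.+ ℚ.∣ s n ℚ.- s N ∣
           ≤⟨ ℚ.+-monoʳ-≤ ℚ.∣ s N ∣ (ℚ.<⇒≤ (h n N N≤n ℕ.≤-refl)) ⟩
         ℚ.∣ s N ∣ ℚ.+ 1ℚ ∎

  *-cauchy : ∀ {s t} → IsCauchy s → IsCauchy t → IsCauchy (λ n → s n ℚ.* t n)
  *-cauchy {s} {t} cs ct ε 0<ε =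
    N , λ m n N≤m N≤n → begin-strict
      ℚ.∣ s m ℚ.* t m ℚ.- s n ℚ.* t n ∣
        ≡⟨ cong ℚ.∣_∣ (solve 4 (λ a b c d →
             a :* b :- c :* d := a :* (b :- d) :+ d :* (a :- c)) refl
             (s m) (t m) (s n) (t n)) ⟩
      ℚ.∣ s m ℚ.* (t m ℚ.- t n) ℚ.+ t n ℚ.* (s m ℚ.- s n) ∣
        ≤⟨ ℚ.∣p+q∣≤∣p∣+∣q∣ (s m ℚ.* (t m ℚ.- t n)) (t n ℚ.* (s m ℚ.- s n)) ⟩
      ℚ.∣ s m ℚ.* (t m ℚ.- t n) ∣ ℚ.+ ℚ.∣ t n ℚ.* (s m ℚ.- s n) ∣
        <⟨ ℚ.+-mono-<
             (small S 0<S (s m) (t m ℚ.- t n)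
               (hS m (ℕ.≤-trans NS≤N N≤m))
               (hδt m n (ℕ.≤-trans Nδt≤N N≤m) (ℕ.≤-trans Nδt≤N N≤n)))
             (small R 0<R (t n) (s m ℚ.- s n)
               (hR n (ℕ.≤-trans NR≤N N≤n))
               (hδs m n (ℕ.≤-trans Nδs≤N N≤m) (ℕ.≤-trans Nδs≤N N≤n))) ⟩
      ½ ℚ.* ε ℚ.+ ½ ℚ.* ε
        ≡⟨ half+half ε ⟩
      ε ∎
    where
    -- the share of ε allotted to a difference multiplied by at most B
    share : ∀ B → 0ℚ ℚ.< B → Σ[ δ ∈ ℚ ] (0ℚ ℚ.< δ × B ℚ.* δ ≡ ½ ℚ.* ε)
    share B 0<B = ℚ.1/ B ℚ.* (½ ℚ.* ε) , 0<δ , Bδ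
      where
      instance
        _ = ℚ.positive 0<B
        _ = ℚ.pos⇒nonZero B
        _ = ℚ.1/pos⇒pos B
      0<δ : 0ℚ ℚ.< ℚ.1/ B ℚ.* (½ ℚ.* ε)
      0<δ = subst (ℚ._< ℚ.1/ B ℚ.* (½ ℚ.* ε)) (ℚ.*-zeroʳ (ℚ.1/ B))
              (ℚ.*-monoʳ-<-pos (ℚ.1/ B) (half-pos ε 0<ε))
      Bδ : B ℚ.* (ℚ.1/ B ℚ.* (½ ℚ.* ε)) ≡ ½ ℚ.* ε
      Bδ = trans (sym (ℚ.*-assoc B (ℚ.1/ B) (½ ℚ.* ε)))
           (trans (cong (ℚ._* (½ ℚ.* ε)) (ℚ.*-inverseʳ B)) (ℚ.*-identityˡ (½ ℚ.* ε)))

    small : ∀ B (0<B : 0ℚ ℚ.< B) a d → ℚ.∣ a ∣ ℚ.≤ B →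
            ℚ.∣ d ∣ ℚ.< proj₁ (share B 0<B) → ℚ.∣ a ℚ.* d ∣ ℚ.< ½ ℚ.* ε
    small B 0<B a d a≤B d<δ = begin-strict
      ℚ.∣ a ℚ.* d ∣          ≡⟨ ℚ.∣p*q∣≡∣p∣*∣q∣ a d ⟩
      ℚ.∣ a ∣ ℚ.* ℚ.∣ d ∣    ≤⟨ ℚ.*-monoʳ-≤-nonNeg ℚ.∣ d ∣ {{ℚ.∣-∣-nonNeg d}} a≤B ⟩
      B ℚ.* ℚ.∣ d ∣          <⟨ ℚ.*-monoʳ-<-pos B {{ℚ.positive 0<B}} d<δ ⟩
      B ℚ.* proj₁ (share B 0<B) ≡⟨ proj₂ (proj₂ (share B 0<B)) ⟩
      ½ ℚ.* ε ∎

    boundS = eventual-bound cs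
    boundR = eventual-bound ct
    S = proj₁ boundS
    R = proj₁ boundR
    0<S = proj₁ (proj₂ boundS)
    0<R = proj₁ (proj₂ boundR)
    NS = proj₁ (proj₂ (proj₂ boundS))
    NR = proj₁ (proj₂ (proj₂ boundR))
    hS = proj₂ (proj₂ (proj₂ boundS))
    hR = proj₂ (proj₂ (proj₂ boundR))
    tailT = ct (proj₁ (share S 0<S)) (proj₁ (proj₂ (share S 0<S)))
    tailS = cs (proj₁ (share R 0<R)) (proj₁ (proj₂ (share R 0<R)))
    Nδt = proj₁ tailT
    Nδs = proj₁ tailS
    hδt = proj₂ tailT
    hδs = proj₂ tailS
    N = (NS ⊔ NR) ⊔ (Nδt ⊔ Nδs)
    NS≤N : NS ℕ.≤ N
    NS≤N = ℕ.≤-trans (ℕ.m≤m⊔n NS NR) (ℕ.m≤m⊔n (NS ⊔ NR) (Nδt ⊔ Nδs))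
    NR≤N : NR ℕ.≤ N
    NR≤N = ℕ.≤-trans (ℕ.m≤n⊔m NS NR) (ℕ.m≤m⊔n (NS ⊔ NR) (Nδt ⊔ Nδs))
    Nδt≤N : Nδt ℕ.≤ N
    Nδt≤N = ℕ.≤-trans (ℕ.m≤m⊔n Nδt Nδs) (ℕ.m≤n⊔m (NS ⊔ NR) (Nδt ⊔ Nδs))
    Nδs≤N : Nδs ℕ.≤ N
    Nδs≤N = ℕ.≤-trans (ℕ.m≤n⊔m Nδt Nδs) (ℕ.m≤n⊔m (NS ⊔ NR) (Nδt ⊔ Nδs))

infixl 6 _+ᴿ_ _-ᴿ_
infixl 7 _*ᴿ_
infix  8 -ᴿ_

fromℚ : ℚ → ℝ
fromℚ q = mkℝ (λ _ → q) (const-cauchy q)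

-- opaque because normalising nested real arithmetic is very expensive
opaque
  _+ᴿ_ : ℝ → ℝ → ℝ
  x +ᴿ y = mkℝ (λ n → seq x n ℚ.+ seq y n) (+-cauchy {seq x} {seq y} (cauchy x) (cauchy y))

  _*ᴿ_ : ℝ → ℝ → ℝ
  x *ᴿ y = mkℝ (λ n → seq x n ℚ.* seq y n) (*-cauchy {seq x} {seq y} (cauchy x) (cauchy y))

  -ᴿ_ : ℝ → ℝ
  -ᴿ x = mkℝ (λ n → ℚ.- seq x n) (neg-cauchy {seq x} (cauchy x))

_-ᴿ_ : ℝ → ℝ → ℝ
x -ᴿ y = x +ᴿ (-ᴿ y)

0ᴿ 1ᴿ : ℝ
0ᴿ = fromℚ 0ℚ
1ᴿ = fromℚ 1ℚ

ℝ-rawRing : RawRing 0ℓ 0ℓ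
ℝ-rawRing = record
  { Carrier = ℝ ; _≈_ = _≈ᴿ_
  ; _+_ = _+ᴿ_ ; _*_ = _*ᴿ_ ; -_ = -ᴿ_ ; 0# = 0ᴿ ; 1# = 1ᴿ }

infix  4 _≈ᶜ_
infixl 6 _+ᶜ_
infixl 7 _*ᶜ_
infix  8 -ᶜ_

record ℂ : Set where
  constructor _+i_
  field
    re im : ℝ

open ℂ public

_≈ᶜ_ : ℂ → ℂ → Set
z ≈ᶜ w = re z ≈ᴿ re w × im z ≈ᴿ im w

_+ᶜ_ _*ᶜ_ : ℂ → ℂ → ℂ
(a +i b) +ᶜ (c +i d) = (a +ᴿ c) +i (b +ᴿ d)
(a +i b) *ᶜ (c +i d) = (a *ᴿ c -ᴿ b *ᴿ d) +i (a *ᴿ d +ᴿ b *ᴿ c)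

-ᶜ_ conj : ℂ → ℂ
-ᶜ (a +i b) = (-ᴿ a) +i (-ᴿ b)
conj (a +i b) = a +i (-ᴿ b)

0ᶜ 1ᶜ : ℂ
0ᶜ = 0ᴿ +i 0ᴿ
1ᶜ = 1ᴿ +i 0ᴿ

∣_∣² : ℂ → ℝ
∣ a +i b ∣² = a *ᴿ a +ᴿ b *ᴿ b

ℂ-rawRing : RawRing 0ℓ 0ℓ
ℂ-rawRing = record
  { Carrier = ℂ ; _≈_ = _≈ᶜ_
  ; _+_ = _+ᶜ_ ; _*_ = _*ᶜ_ ; -_ = -ᶜ_ ; 0# = 0ᶜ ; 1# = 1ᶜ }

open RawMonoidSum (RawRing.+-rawMonoid ℝ-rawRing) public
  using () renaming (sum to sumᴿ)
open RawMonoidSum (RawRing.*-rawMonoid ℝ-rawRing) public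
  using () renaming (sum to productᴿ)
open RawMonoidSum (RawRing.+-rawMonoid ℂ-rawRing) public
  using () renaming (sum to sumᶜ)

-- Partial Boolean functions.  The domain is given by its characteristic
-- function, so that membership T (domain x) is proof-irrelevant.
record PartialBoolFun (n : ℕ) : Set where
  field
    domain : Vec Bool n → Bool
    value  : ∀ x → T (domain x) → Bool

open PartialBoolFun public

-- Every element of {0,1}ⁿ, exactly once.
cube : ∀ n → List (Vec Bool n)
cube zero    = [] ∷ []
cube (suc n) = List.map (false ∷_) (cube n) ++ List.map (true ∷_) (cube n)

domainSize : ∀ {n} → PartialBoolFun n → ℕ
domainSize {n} f = List.length (List.filterᵇ (domain f) (cube n))

bit : Bool → ℝ
bit b = if b then 1ᴿ else 0ᴿ

-- p S is the coefficient of the monomial ∏_{i ∈ S} xᵢ.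
MultilinearPoly : ℕ → Set
MultilinearPoly n = Subset n → ℝ

monomial : ∀ {n} → Subset n → Vec Bool n → ℝ
monomial S x = productᴿ (λ i → if lookup S i then bit (lookup x i) else 1ᴿ)

-- Subset n is Vec Bool n, so cube n also enumerates the subsets of Fin n.
eval : ∀ {n} → MultilinearPoly n → Vec Bool n → ℝ
eval {n} p x = List.foldr _+ᴿ_ 0ᴿ (List.map (λ S → p S *ᴿ monomial S x) (cube n))

Represents : ∀ {n} → MultilinearPoly n → PartialBoolFun n → Set
Represents p f = ∀ x (x∈D : T (domain f x)) → eval p x ≈ᴿ bit (value f x x∈D)

Occurs : ∀ {n} → MultilinearPoly n → Fin n → Set
Occurs p i = ∃[ S ] (i ∈ S × ¬ (p S ≈ᴿ 0ᴿ))

-- A relation rather than a function, since equality of reals is undecidable.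
NumVars : ∀ {n} → MultilinearPoly n → ℕ → Set
NumVars {n} p k = Σ[ V ∈ Subset n ] ((∀ i → i ∈ V ⇔ Occurs p i) × ∣ V ∣ ≡ k)

DependsOnBits : ∀ {n} → PartialBoolFun n → ℕ → Set
DependsOnBits f k =
  (∃[ p ] (Represents p f × NumVars p k)) ×
  (∀ p j → Represents p f → NumVars p j → k ℕ.≤ j)

-- States and operators, in coordinates with respect to the orthonormal
-- basis ∣i,j⟩ with i ∈ {0,…,n} and j in a set of m elements.
Basis : ℕ → ℕ → Set
Basis n m = Fin (suc n) × Fin m

State : ℕ → ℕ → Set
State n m = Basis n m → ℂ

-- U a b = ⟨a∣U∣b⟩
Operator : ℕ → ℕ → Set
Operator n m = Basis n m → Basis n m → ℂ

module _ {n m : ℕ} where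

  infix  4 _≈ᴼ_
  infixl 6 _+ᴼ_
  infixl 7 _·_
  infixr 7 _▷_
  infix  9 _†

  normSq : State n m → ℝ
  normSq v = sumᴿ (λ i → sumᴿ (λ j → ∣ v (i , j) ∣²))

  sumBasis : State n m → ℂ
  sumBasis v = sumᶜ (λ i → sumᶜ (λ j → v (i , j)))

  _▷_ : Operator n m → State n m → State n m
  (U ▷ v) a = sumBasis (λ b → U a b *ᶜ v b)

  _·_ : Operator n m → Operator n m → Operator n m
  (U · V) a c = sumBasis (λ b → U a b *ᶜ V b c)

  _† : Operator n m → Operator n m
  (U †) a b = conj (U b a)

  _+ᴼ_ : Operator n m → Operator n m → Operator n m
  (U +ᴼ V) a b = U a b +ᶜ V a b

  𝟘 𝟙 : Operator n m
  𝟘 _ _ = 0ᶜ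
  𝟙 (i , j) (i′ , j′) = if does (i Fin.≟ i′) ∧ does (j Fin.≟ j′) then 1ᶜ else 0ᶜ

  _≈ᴼ_ : Operator n m → Operator n m → Set
  U ≈ᴼ V = ∀ a b → U a b ≈ᶜ V a b

  IsUnitary : Operator n m → Set
  IsUnitary U = U † · U ≈ᴼ 𝟙 × U · U † ≈ᴼ 𝟙

  record IsProjectiveMeasurement (P : Bool → Operator n m) : Set where
    field
      selfAdjoint : ∀ b → P b † ≈ᴼ P b
      idempotent  : ∀ b → P b · P b ≈ᴼ P b
      orthogonal  : ∀ b → P b · P (not b) ≈ᴼ 𝟘
      complete    : P false +ᴼ P true ≈ᴼ 𝟙

phase : ∀ {n} → Vec Bool n → Fin (suc n) → ℂ
phase x zero    = 1ᶜ
phase x (suc i) = if lookup x i then -ᶜ 1ᶜ else 1ᶜ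

oracle : ∀ {n m} → Vec Bool n → State n m → State n m
oracle x v (i , j) = phase x i *ᶜ v (i , j)

record OneQueryAlgorithm (n : ℕ) : Set where
  field
    m             : ℕ
    ψ₀            : State n m
    U₀ U₁         : Operator n m
    P             : Bool → Operator n m
    ψ₀-normalised : normSq ψ₀ ≈ᴿ 1ᴿ
    U₀-unitary    : IsUnitary U₀
    U₁-unitary    : IsUnitary U₁
    P-measurement : IsProjectiveMeasurement P

  finalState : Vec Bool n → State n m
  finalState x = U₁ ▷ oracle x (U₀ ▷ ψ₀)

  probability : Vec Bool n → Bool → ℝ
  probability x b = normSq (P b ▷ finalState x)

ComputesExactly : ∀ {n} → OneQueryAlgorithm n → PartialBoolFun n → Set
ComputesExactly A f =
  ∀ x (x∈D : T (domain f x)) →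
    OneQueryAlgorithm.probability A x (value f x x∈D) ≈ᴿ 1ᴿ

ExactlyOneQueryComputable : ∀ {n} → PartialBoolFun n → Set
ExactlyOneQueryComputable {n} f = Σ[ A ∈ OneQueryAlgorithm n ] ComputesExactly A f

AgreesOnDomain : ∀ {n} → PartialBoolFun n → (Vec Bool n → Bool) → Set
AgreesOnDomain f g = ∀ x (x∈D : T (domain f x)) → value f x x∈D ≡ g x

x₁ : ∀ {n} → Vec Bool (suc n) → Bool
x₁ x = lookup x zero

x₂ : ∀ {n} → Vec Bool (suc (suc n)) → Bool
x₂ x = lookup x (suc zero)

OneBitCase : PartialBoolFun 1 → Set
OneBitCase f =
  (∀ x → T (domain f x)) ×
  (AgreesOnDomain f x₁ ⊎ AgreesOnDomain f (λ x → true xor x₁ x))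

TwoBitCase : PartialBoolFun 2 → Set
TwoBitCase f =
  (domainSize f ≡ 3 ⊎ domainSize f ≡ 4) ×
  (AgreesOnDomain f (λ x → x₁ x xor x₂ x) ⊎
   AgreesOnDomain f (λ x → true xor (x₁ x xor x₂ x)))

{-# OPTIONS --safe #-}
module Submission where

-- If the final states for inputs x and y with f x ≠ f y are both measured with certainty, they are
-- orthogonal.  Unitarity reduces their inner product to ∑ᵢ wᵢ (-1)^(xᵢ + yᵢ), where wᵢ is the squared
-- norm of the part of the state sitting at query position i, so the weights of the positions where x
-- and y differ sum to 1/2.  If f depends on all n bits, then for every i some such pair differs in bit
-- i only: otherwise f extends to a total function ignoring bit i, whose multilinear interpolation has
-- fewer than n variables.  Hence wᵢ = 1/2 for 1 ≤ i ≤ n, and n ≤ 2.  For n = 2 two antipodal inputs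
-- would be at weighted distance 1, so they get the same value, which leaves only the parity.
-- Conversely, with weight 1/2 on each of two positions (position 0 being one of them if n = 1) the
-- queried states are parallel or orthogonal to the initial one according to the parity.

open import Defs
open import Algebra.Bundles using (CommutativeRing)
import Algebra.Properties.AbelianGroup as AbelianGroupProperties
import Algebra.Properties.Ring as RingProperties
import Algebra.Properties.Semiring.Sum as SemiringSum
import Algebra.Solver.Ring as RingSolver
open import Algebra.Solver.Ring.AlmostCommutativeRing using (fromCommutativeRing; _-Raw-AlmostCommutative⟶_)
open import Data.Bool.Base using (Bool; true; false; not; _∧_; _∨_; _xor_; if_then_else_; T)
open import Data.Bool.Properties as Bool
  using (¬-not; T?; T-irrelevant; ∨-comm; xor-same; not-distribˡ-xor; not-distribʳ-xor; not-involutive)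
open import Data.Fin.Base using (Fin; zero; suc)
open import Data.Fin.Patterns using (0F; 1F; 2F)
import Data.Fin.Properties as Fin
open import Data.Fin.Subset using (Subset; _∈_; ∣_∣)
open import Data.Fin.Subset.Properties using (anySubset?; _∈?_; ∈⊤; ∣p∣≤n; ∣p∣≡n⇒p≡⊤)
open import Data.List.Base as List using (List; []; _∷_; _++_)
open import Data.Maybe.Base as Maybe using (Maybe)
open import Data.Nat.Base as ℕ using (ℕ; zero; suc; _⊔_; _≤_)
import Data.Nat.ListAction as ListAction
import Data.Nat.Properties as ℕ
open import Data.Product.Base using (∃-syntax; Σ-syntax; _×_; _,_; proj₁; proj₂)
open import Data.Rational.Base as ℚ using (ℚ; 0ℚ; 1ℚ; ½)
  renaming (_+_ to _+ℚ_; _*_ to _*ℚ_; _-_ to _-ℚ_; -_ to -ℚ_; _<_ to _<ℚ_; ∣_∣ to ∣_∣ℚ)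
import Data.Rational.Properties as ℚ
open import Data.Rational.Solver using (module +-*-Solver)
open import Algebra.Properties.Group ℚ.+-0-group using () renaming (⁻¹-involutive to -‿involutive)
open import Data.Sum.Base using (_⊎_; inj₁; inj₂; [_,_]′)
open import Data.Vec.Base using (Vec; []; _∷_; lookup; replicate; _[_]%=_; tabulate; here; there)
open import Data.Vec.Properties using (lookup∘tabulate; lookup-replicate; []=⇒lookup; lookup⇒[]=)
open import Function.Base using (_∘_)
open import Function.Bundles using (_⇔_; mk⇔)
open import Level using (0ℓ)
import Relation.Binary.Reasoning.Setoid as ≈-Reasoning
open import Relation.Binary.PropositionalEquality as ≡ using (_≡_; _≢_; ≢-sym; cong; cong₂; subst; subst₂)
open import Relation.Nullary using (¬_; Dec; yes; no; contradiction; does)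
open import Relation.Nullary.Decidable using (dec⇒maybe; map′; ¬?; _×-dec_; dec-true; decidable-stable; does-⇔)

-- The ring of real numbers

-- Equality of reals is undecidable, and this decides where searches and case distinctions take
-- place. `NumVars` asks for an actual subset consisting of the occurring variables, so the
-- interpolating polynomial is given rational coefficients, whose vanishing can be tested. Conflicts
-- concern only Booleans, so sensitive bits are found by finite search. The value 1/2 arises because
-- two queried states have inner product 1 - 2h, where h is the weighted Hamming distance of the
-- inputs: each weight at a differing bit changes sign. Position 0 never contributes to h; its own
-- weight is what makes the remaining weights sum to at most 1. All that the classification takes
-- from an algorithm is therefore a family of weights, and the rest is combinatorics of the cube.
-- The order on the reals is needed to pass from probability 0 to a zero vector, because a sum of
-- squares has to vanish termwise. For one bit, a conflicting pair is already the whole cube. For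
-- two bits, a corner in conflict with both of its neighbours places three points in the domain, and
-- f is compared with the parity relative to that corner.

Eventually : (ℕ → Set) → Set
Eventually P = ∃[ N ] (∀ n → N ≤ n → P n)

eventually-map : ∀ {P Q : ℕ → Set} → (∀ n → P n → Q n) → Eventually P → Eventually Q
eventually-map g (N , p) = N , λ n N≤n → g n (p n N≤n)

eventually-zip : ∀ {P Q R : ℕ → Set} → (∀ n → P n → Q n → R n) →
                 Eventually P → Eventually Q → Eventually R
eventually-zip g (M , p) (N , q) = M ⊔ N , λ n M⊔N≤n →
  g n (p n (ℕ.m⊔n≤o⇒m≤o M N M⊔N≤n)) (q n (ℕ.m⊔n≤o⇒n≤o M N M⊔N≤n))

eventually-witness : ∀ {P : ℕ → Set} → Eventually P → ∃[ n ] P n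
eventually-witness (N , p) = N , p N ℕ.≤-refl

0<½* : ∀ {ε} → 0ℚ <ℚ ε → 0ℚ <ℚ ½ *ℚ ε
0<½* = ℚ.*-monoʳ-<-pos ½

½+½ : ∀ ε → ½ *ℚ ε +ℚ ½ *ℚ ε ≡ ε
½+½ ε = ≡.trans (≡.sym (ℚ.*-distribʳ-+ ε ½ ½)) (ℚ.*-identityˡ ε)

-- `x ≈ᴿ y` says exactly that the difference of the two sequences is null, so the closure properties
-- of null sequences become the congruence laws of the ring.
Null : (ℕ → ℚ) → Set
Null s = ∀ ε → 0ℚ <ℚ ε → Eventually (λ n → ∣ s n ∣ℚ <ℚ ε)

Bounded : (ℕ → ℚ) → Set
Bounded s = Σ[ B ∈ ℚ ] (0ℚ <ℚ B × Eventually (λ n → ∣ s n ∣ℚ ℚ.≤ B))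

module _ where
  open ℚ.≤-Reasoning

  null-cong : ∀ {s t} → (∀ n → s n ≡ t n) → Null s → Null t
  null-cong s≗t s→0 ε 0<ε = eventually-map (λ n → subst (λ q → ∣ q ∣ℚ <ℚ ε) (s≗t n)) (s→0 ε 0<ε)

  null-zero : Null (λ _ → 0ℚ)
  null-zero ε 0<ε = 0 , λ _ _ → 0<ε

  null-neg : ∀ {s} → Null s → Null (λ n → -ℚ s n)
  null-neg {s} s→0 ε 0<ε =
    eventually-map (λ n → subst (_<ℚ ε) (≡.sym (ℚ.∣-p∣≡∣p∣ (s n)))) (s→0 ε 0<ε)

  null-+ : ∀ {s t} → Null s → Null t → Null (λ n → s n +ℚ t n)
  null-+ {s} {t} s→0 t→0 ε 0<ε = eventually-zip
    (λ n ∣s∣<ε/2 ∣t∣<ε/2 → begin-strict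
      ∣ s n +ℚ t n ∣ℚ          ≤⟨ ℚ.∣p+q∣≤∣p∣+∣q∣ (s n) (t n) ⟩
      ∣ s n ∣ℚ +ℚ ∣ t n ∣ℚ     <⟨ ℚ.+-mono-< ∣s∣<ε/2 ∣t∣<ε/2 ⟩
      ½ *ℚ ε +ℚ ½ *ℚ ε         ≡⟨ ½+½ ε ⟩
      ε                        ∎)
    (s→0 _ (0<½* 0<ε)) (t→0 _ (0<½* 0<ε))

  -- If B eventually bounds the second factor, making the first smaller than ε/B makes the product
  -- smaller than ε.
  null-*-bounded : ∀ {s t} → Null s → Bounded t → Null (λ n → s n *ℚ t n)
  null-*-bounded {s} {t} s→0 (B , 0<B , ∣t∣≤B) ε 0<ε = eventually-zip
    (λ n ∣s∣<δ ∣t∣≤B → begin-strict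
      ∣ s n *ℚ t n ∣ℚ         ≡⟨ ℚ.∣p*q∣≡∣p∣*∣q∣ (s n) (t n) ⟩
      ∣ s n ∣ℚ *ℚ ∣ t n ∣ℚ    ≤⟨ ℚ.*-monoˡ-≤-nonNeg ∣ s n ∣ℚ {{ℚ.∣-∣-nonNeg (s n)}} ∣t∣≤B ⟩
      ∣ s n ∣ℚ *ℚ B           <⟨ ℚ.*-monoˡ-<-pos B ∣s∣<δ ⟩
      ε *ℚ ℚ.1/ B *ℚ B        ≡⟨ ℚ.*-assoc ε (ℚ.1/ B) B ⟩
      ε *ℚ (ℚ.1/ B *ℚ B)      ≡⟨ cong (ε *ℚ_) (ℚ.*-inverseˡ B) ⟩
      ε *ℚ 1ℚ                 ≡⟨ ℚ.*-identityʳ ε ⟩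
      ε                       ∎)
    (s→0 (ε *ℚ ℚ.1/ B) 0<ε/B) ∣t∣≤B
    where
    instance
      _ = ℚ.positive 0<B
      _ = ℚ.pos⇒nonZero B
      _ = ℚ.1/pos⇒pos B
    0<ε/B : 0ℚ <ℚ ε *ℚ ℚ.1/ B
    0<ε/B = subst (_<ℚ ε *ℚ ℚ.1/ B) (ℚ.*-zeroˡ (ℚ.1/ B)) (ℚ.*-monoˡ-<-pos (ℚ.1/ B) 0<ε)

  cauchy⇒bounded : ∀ {s} → IsCauchy s → Bounded s
  cauchy⇒bounded {s} s-cauchy with N , near ← s-cauchy 1ℚ (ℚ.positive⁻¹ 1ℚ) =
      ∣ s N ∣ℚ +ℚ 1ℚ
    , ℚ.+-mono-≤-< (ℚ.0≤∣p∣ (s N)) (ℚ.positive⁻¹ 1ℚ)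
    , N
    , λ n N≤n → begin
        ∣ s n ∣ℚ
          ≡⟨ cong ∣_∣ℚ (solve 2 (λ a b → a := b :+ (a :- b)) ≡.refl (s n) (s N)) ⟩
        ∣ s N +ℚ (s n -ℚ s N) ∣ℚ
          ≤⟨ ℚ.∣p+q∣≤∣p∣+∣q∣ (s N) (s n -ℚ s N) ⟩
        ∣ s N ∣ℚ +ℚ ∣ s n -ℚ s N ∣ℚ
          ≤⟨ ℚ.+-monoʳ-≤ ∣ s N ∣ℚ (ℚ.<⇒≤ (near n N N≤n ℕ.≤-refl)) ⟩
        ∣ s N ∣ℚ +ℚ 1ℚ ∎
    where open +-*-Solver

opaque
  unfolding _+ᴿ_

  -- The operations act term by term, so every ring law below is inherited from the same law of the
  -- rationals.
  pointwise : ∀ {x y} → (∀ n → seq x n ≡ seq y n) → x ≈ᴿ y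
  pointwise {x} {y} x≗y = mk≈ (null-cong
    (λ n → ≡.sym (≡.trans (cong (_-ℚ seq y n) (x≗y n)) (ℚ.+-inverseʳ (seq y n)))) null-zero)

  ≈ᴿ-sym : ∀ {x y} → x ≈ᴿ y → y ≈ᴿ x
  ≈ᴿ-sym {x} {y} x≈y = mk≈ (null-cong
    (λ n → solve 2 (λ a b → :- (a :- b) := b :- a) ≡.refl (seq x n) (seq y n))
    (null-neg (close x≈y)))
    where open +-*-Solver

  ≈ᴿ-trans : ∀ {x y z} → x ≈ᴿ y → y ≈ᴿ z → x ≈ᴿ z
  ≈ᴿ-trans {x} {y} {z} x≈y y≈z = mk≈ (null-cong
    (λ n → solve 3 (λ a b c → (a :- b) :+ (b :- c) := a :- c) ≡.refl (seq x n) (seq y n) (seq z n))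
    (null-+ (close x≈y) (close y≈z)))
    where open +-*-Solver

  +ᴿ-cong : ∀ {x x′ y y′} → x ≈ᴿ x′ → y ≈ᴿ y′ → x +ᴿ y ≈ᴿ x′ +ᴿ y′
  +ᴿ-cong {x} {x′} {y} {y′} x≈x′ y≈y′ = mk≈ (null-cong
    (λ n → solve 4 (λ a a′ b b′ → (a :- a′) :+ (b :- b′) := (a :+ b) :- (a′ :+ b′)) ≡.refl
             (seq x n) (seq x′ n) (seq y n) (seq y′ n))
    (null-+ (close x≈x′) (close y≈y′)))
    where open +-*-Solver

  -- The difference of the products splits into two terms, each a null difference times a Cauchy,
  -- hence eventually bounded, sequence.
  *ᴿ-cong : ∀ {x x′ y y′} → x ≈ᴿ x′ → y ≈ᴿ y′ → x *ᴿ y ≈ᴿ x′ *ᴿ y′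
  *ᴿ-cong {x} {x′} {y} {y′} x≈x′ y≈y′ = mk≈ (null-cong
    (λ n → solve 4 (λ a a′ b b′ →
               (a :- a′) :* b :+ (b :- b′) :* a′ := (a :* b) :- (a′ :* b′)) ≡.refl
             (seq x n) (seq x′ n) (seq y n) (seq y′ n))
    (null-+ (null-*-bounded (close x≈x′) (cauchy⇒bounded (cauchy y)))
            (null-*-bounded (close y≈y′) (cauchy⇒bounded (cauchy x′)))))
    where open +-*-Solver

  -ᴿ-cong : ∀ {x x′} → x ≈ᴿ x′ → -ᴿ x ≈ᴿ -ᴿ x′
  -ᴿ-cong {x} {x′} x≈x′ = mk≈ (null-cong
    (λ n → solve 2 (λ a a′ → :- (a :- a′) := :- a :- :- a′) ≡.refl (seq x n) (seq x′ n))
    (null-neg (close x≈x′)))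
    where open +-*-Solver

  +ᴿ-assoc : ∀ x y z → (x +ᴿ y) +ᴿ z ≈ᴿ x +ᴿ (y +ᴿ z)
  +ᴿ-assoc x y z = pointwise λ n → ℚ.+-assoc (seq x n) (seq y n) (seq z n)

  +ᴿ-comm : ∀ x y → x +ᴿ y ≈ᴿ y +ᴿ x
  +ᴿ-comm x y = pointwise λ n → ℚ.+-comm (seq x n) (seq y n)

  +ᴿ-identityˡ : ∀ x → 0ᴿ +ᴿ x ≈ᴿ x
  +ᴿ-identityˡ x = pointwise λ n → ℚ.+-identityˡ (seq x n)

  +ᴿ-identityʳ : ∀ x → x +ᴿ 0ᴿ ≈ᴿ x
  +ᴿ-identityʳ x = pointwise λ n → ℚ.+-identityʳ (seq x n)

  -ᴿ-inverseˡ : ∀ x → -ᴿ x +ᴿ x ≈ᴿ 0ᴿ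
  -ᴿ-inverseˡ x = pointwise λ n → ℚ.+-inverseˡ (seq x n)

  -ᴿ-inverseʳ : ∀ x → x +ᴿ -ᴿ x ≈ᴿ 0ᴿ
  -ᴿ-inverseʳ x = pointwise λ n → ℚ.+-inverseʳ (seq x n)

  *ᴿ-assoc : ∀ x y z → (x *ᴿ y) *ᴿ z ≈ᴿ x *ᴿ (y *ᴿ z)
  *ᴿ-assoc x y z = pointwise λ n → ℚ.*-assoc (seq x n) (seq y n) (seq z n)

  *ᴿ-comm : ∀ x y → x *ᴿ y ≈ᴿ y *ᴿ x
  *ᴿ-comm x y = pointwise λ n → ℚ.*-comm (seq x n) (seq y n)

  *ᴿ-identityˡ : ∀ x → 1ᴿ *ᴿ x ≈ᴿ x
  *ᴿ-identityˡ x = pointwise λ n → ℚ.*-identityˡ (seq x n)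

  *ᴿ-identityʳ : ∀ x → x *ᴿ 1ᴿ ≈ᴿ x
  *ᴿ-identityʳ x = pointwise λ n → ℚ.*-identityʳ (seq x n)

  *ᴿ-distribˡ : ∀ x y z → x *ᴿ (y +ᴿ z) ≈ᴿ x *ᴿ y +ᴿ x *ᴿ z
  *ᴿ-distribˡ x y z = pointwise λ n → ℚ.*-distribˡ-+ (seq x n) (seq y n) (seq z n)

  *ᴿ-distribʳ : ∀ x y z → (y +ᴿ z) *ᴿ x ≈ᴿ y *ᴿ x +ᴿ z *ᴿ x
  *ᴿ-distribʳ x y z = pointwise λ n → ℚ.*-distribʳ-+ (seq x n) (seq y n) (seq z n)

  fromℚ-+ : ∀ p q → fromℚ (p +ℚ q) ≈ᴿ fromℚ p +ᴿ fromℚ q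
  fromℚ-+ p q = pointwise λ _ → ≡.refl

  fromℚ-* : ∀ p q → fromℚ (p *ℚ q) ≈ᴿ fromℚ p *ᴿ fromℚ q
  fromℚ-* p q = pointwise λ _ → ≡.refl

  fromℚ-neg : ∀ p → fromℚ (-ℚ p) ≈ᴿ -ᴿ fromℚ p
  fromℚ-neg p = pointwise λ _ → ≡.refl

≈ᴿ-refl : ∀ {x} → x ≈ᴿ x
≈ᴿ-refl = pointwise λ _ → ≡.refl

≈ᴿ-reflexive : ∀ {x y} → x ≡ y → x ≈ᴿ y
≈ᴿ-reflexive ≡.refl = ≈ᴿ-refl

ℝ-ring : CommutativeRing 0ℓ 0ℓ
ℝ-ring = record
  { Carrier = ℝ ; _≈_ = _≈ᴿ_ ; _+_ = _+ᴿ_ ; _*_ = _*ᴿ_ ; -_ = -ᴿ_ ; 0# = 0ᴿ ; 1# = 1ᴿ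
  ; isCommutativeRing = record
    { isRing = record
      { +-isAbelianGroup = record
        { isGroup = record
          { isMonoid = record
            { isSemigroup = record
              { isMagma = record
                { isEquivalence = record { refl = ≈ᴿ-refl ; sym = ≈ᴿ-sym ; trans = ≈ᴿ-trans }
                ; ∙-cong = +ᴿ-cong }
              ; assoc = +ᴿ-assoc }
            ; identity = +ᴿ-identityˡ , +ᴿ-identityʳ }
          ; inverse = -ᴿ-inverseˡ , -ᴿ-inverseʳ
          ; ⁻¹-cong = -ᴿ-cong }
        ; comm = +ᴿ-comm }
      ; *-cong = *ᴿ-cong
      ; *-assoc = *ᴿ-assoc
      ; *-identity = *ᴿ-identityˡ , *ᴿ-identityʳ
      ; distrib = *ᴿ-distribˡ , *ᴿ-distribʳ }
    ; *-comm = *ᴿ-comm } }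

fromℚ-morphism : ℚ.+-*-rawRing -Raw-AlmostCommutative⟶ fromCommutativeRing ℝ-ring
fromℚ-morphism = record
  { ⟦_⟧ = fromℚ ; +-homo = fromℚ-+ ; *-homo = fromℚ-* ; -‿homo = fromℚ-neg
  ; 0-homo = ≈ᴿ-refl ; 1-homo = ≈ᴿ-refl }

-- The ring solver compares coefficients. Taking them in ℚ makes this comparison decidable and lets
-- constants such as ½ occur in solved identities.
fromℚ-≟ : ∀ p q → Maybe (fromℚ p ≈ᴿ fromℚ q)
fromℚ-≟ p q = Maybe.map (λ { ≡.refl → ≈ᴿ-refl }) (dec⇒maybe (p ℚ.≟ q))

module ℝ-Solver = RingSolver ℚ.+-*-rawRing (fromCommutativeRing ℝ-ring) fromℚ-morphism fromℚ-≟

-- A constant sequence cannot come closer to 0 than its own absolute value, which serves as the ε.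
fromℚ≈0⇒≡0 : ∀ {q} → fromℚ q ≈ᴿ 0ᴿ → q ≡ 0ℚ
fromℚ≈0⇒≡0 {q} q≈0 with q ℚ.≟ 0ℚ
... | yes q≡0 = q≡0
... | no q≢0 = contradiction (proj₂ (eventually-witness (close q≈0 ∣ q -ℚ 0ℚ ∣ℚ 0<∣q-0∣))) (ℚ.<-irrefl ≡.refl)
  where
  q-0≡q : q -ℚ 0ℚ ≡ q
  q-0≡q = ℚ.+-identityʳ q
  0<∣q-0∣ : 0ℚ <ℚ ∣ q -ℚ 0ℚ ∣ℚ
  0<∣q-0∣ = ℚ.≰⇒> λ ∣q-0∣≤0 →
    q≢0 (≡.trans (≡.sym q-0≡q) (ℚ.∣p∣≡0⇒p≡0 _ (ℚ.≤-antisym ∣q-0∣≤0 (ℚ.0≤∣p∣ (q -ℚ 0ℚ)))))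

-- Nonnegative reals

-- The slack ε makes the notion invariant under `_≈ᴿ_`: a sequence tending to 0 from below still
-- represents a nonnegative real.
NonNegative : ℝ → Set
NonNegative x = ∀ ε → 0ℚ <ℚ ε → Eventually (λ n → -ℚ ε <ℚ seq x n)

0≤p² : ∀ p → 0ℚ ℚ.≤ p *ℚ p
0≤p² p with ℚ.≤-total 0ℚ p
... | inj₁ 0≤p = ℚ.nonNegative⁻¹ _ {{ℚ.nonNeg*nonNeg⇒nonNeg p p}}
  where instance _ = ℚ.nonNegative 0≤p
... | inj₂ p≤0 = ℚ.nonNegative⁻¹ _ {{ℚ.nonPos*nonPos⇒nonPos p p}}
  where instance _ = ℚ.nonPositive p≤0

neg<0 : ∀ {ε} → 0ℚ <ℚ ε → -ℚ ε <ℚ 0ℚ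
neg<0 = ℚ.neg-antimono-<

-∣p∣≤p : ∀ p → -ℚ ∣ p ∣ℚ ℚ.≤ p
-∣p∣≤p p with ℚ.∣p∣≡p∨∣p∣≡-p p
... | inj₁ ∣p∣≡p  = ℚ.≤-trans (ℚ.neg-antimono-≤ (ℚ.0≤∣p∣ p)) (ℚ.∣p∣≡p⇒0≤p ∣p∣≡p)
... | inj₂ ∣p∣≡-p = ℚ.≤-reflexive (≡.trans (cong -ℚ_ ∣p∣≡-p) (-‿involutive p))

p²<ε²⇒∣p∣<ε : ∀ {p ε} → 0ℚ <ℚ ε → ∣ p *ℚ p ∣ℚ <ℚ ε *ℚ ε → ∣ p ∣ℚ <ℚ ε
p²<ε²⇒∣p∣<ε {p} {ε} 0<ε p²<ε² = ℚ.≰⇒> λ ε≤∣p∣ → ℚ.<-irrefl ≡.refl (begin-strict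
  ∣ p *ℚ p ∣ℚ         <⟨ p²<ε² ⟩
  ε *ℚ ε              ≤⟨ ℚ.*-monoˡ-≤-nonNeg ε {{ℚ.nonNegative (ℚ.<⇒≤ 0<ε)}} ε≤∣p∣ ⟩
  ε *ℚ ∣ p ∣ℚ         ≤⟨ ℚ.*-monoʳ-≤-nonNeg ∣ p ∣ℚ {{ℚ.∣-∣-nonNeg p}} ε≤∣p∣ ⟩
  ∣ p ∣ℚ *ℚ ∣ p ∣ℚ    ≡⟨ ℚ.∣p*q∣≡∣p∣*∣q∣ p p ⟨
  ∣ p *ℚ p ∣ℚ         ∎)
  where open ℚ.≤-Reasoning

nonNegative-0 : NonNegative 0ᴿ
nonNegative-0 ε 0<ε = 0 , λ _ _ → neg<0 0<ε

nonNegative-resp : ∀ {x y} → x ≈ᴿ y → NonNegative x → NonNegative y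
nonNegative-resp {x} {y} x≈y 0≤x ε 0<ε = eventually-zip
  (λ n ∣y-x∣<ε/2 -ε/2<x → begin-strict
    -ℚ ε
      ≡⟨ cong -ℚ_ (½+½ ε) ⟨
    -ℚ (½ *ℚ ε +ℚ ½ *ℚ ε)
      ≡⟨ ℚ.neg-distrib-+ (½ *ℚ ε) (½ *ℚ ε) ⟩
    -ℚ (½ *ℚ ε) +ℚ -ℚ (½ *ℚ ε)
      <⟨ ℚ.+-mono-< -ε/2<x (ℚ.<-≤-trans (ℚ.neg-antimono-< ∣y-x∣<ε/2) (-∣p∣≤p (seq y n -ℚ seq x n))) ⟩
    seq x n +ℚ (seq y n -ℚ seq x n)
      ≡⟨ solve 2 (λ a b → a :+ (b :- a) := b) ≡.refl (seq x n) (seq y n) ⟩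
    seq y n ∎)
  (close (≈ᴿ-sym x≈y) _ (0<½* 0<ε)) (0≤x _ (0<½* 0<ε))
  where
  open ℚ.≤-Reasoning
  open +-*-Solver

opaque
  unfolding _+ᴿ_

  nonNegative-+ : ∀ {x y} → NonNegative x → NonNegative y → NonNegative (x +ᴿ y)
  nonNegative-+ {x} {y} 0≤x 0≤y ε 0<ε = eventually-zip
    (λ n -ε/2<x -ε/2<y → subst (_<ℚ seq x n +ℚ seq y n)
      (≡.trans (≡.sym (ℚ.neg-distrib-+ (½ *ℚ ε) (½ *ℚ ε))) (cong -ℚ_ (½+½ ε)))
      (ℚ.+-mono-< -ε/2<x -ε/2<y))
    (0≤x _ (0<½* 0<ε)) (0≤y _ (0<½* 0<ε))

  nonNegative-square : ∀ x → NonNegative (x *ᴿ x)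
  nonNegative-square x ε 0<ε = 0 , λ n _ → ℚ.<-≤-trans (neg<0 0<ε) (0≤p² (seq x n))

  nonNegative-antisym : ∀ {x} → NonNegative x → NonNegative (-ᴿ x) → x ≈ᴿ 0ᴿ
  nonNegative-antisym {x} 0≤x 0≤-x = mk≈ λ ε 0<ε → eventually-zip
    (λ n -ε<x -ε<-x → subst (λ p → ∣ p ∣ℚ <ℚ ε) (≡.sym (ℚ.+-identityʳ (seq x n)))
      (∣∣-bound (seq x n) -ε<x -ε<-x))
    (0≤x ε 0<ε) (0≤-x ε 0<ε)
    where
    ∣∣-bound : ∀ p {ε} → -ℚ ε <ℚ p → -ℚ ε <ℚ -ℚ p → ∣ p ∣ℚ <ℚ ε
    ∣∣-bound p {ε} -ε<p -ε<-p with ℚ.∣p∣≡p∨∣p∣≡-p p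
    ... | inj₁ ∣p∣≡p  = subst (_<ℚ ε) (≡.sym ∣p∣≡p) (subst₂ _<ℚ_ (-‿involutive p) (-‿involutive ε) (ℚ.neg-antimono-< -ε<-p))
    ... | inj₂ ∣p∣≡-p = subst₂ _<ℚ_ (≡.sym ∣p∣≡-p) (-‿involutive ε) (ℚ.neg-antimono-< -ε<p)

  -- Closeness of the square is requested at ε², which bounds the root by ε.
  square≈0⇒≈0 : ∀ {x} → x *ᴿ x ≈ᴿ 0ᴿ → x ≈ᴿ 0ᴿ
  square≈0⇒≈0 {x} x²≈0 = mk≈ λ ε 0<ε → eventually-map
    (λ n ∣x²∣<ε² → subst (λ p → ∣ p ∣ℚ <ℚ ε) (≡.sym (ℚ.+-identityʳ (seq x n)))
      (p²<ε²⇒∣p∣<ε 0<ε (subst (λ p → ∣ p ∣ℚ <ℚ ε *ℚ ε) (ℚ.+-identityʳ (seq x n *ℚ seq x n)) ∣x²∣<ε²)))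
    (close x²≈0 (ε *ℚ ε) (subst (_<ℚ ε *ℚ ε) (ℚ.*-zeroʳ ε) (ℚ.*-monoʳ-<-pos ε {{ℚ.positive 0<ε}} 0<ε)))

-- If q were negative, the slack ε = -q would give q < q.
nonNegative-fromℚ⇒0≤ : ∀ {q} → NonNegative (fromℚ q) → 0ℚ ℚ.≤ q
nonNegative-fromℚ⇒0≤ {q} 0≤q = ℚ.≮⇒≥ λ q<0 → ℚ.<-irrefl (-‿involutive q)
  (proj₂ (eventually-witness (0≤q (-ℚ q) (ℚ.neg-antimono-< q<0))))

sumᴿ-nonNegative : ∀ {n} {f : Fin n → ℝ} → (∀ i → NonNegative (f i)) → NonNegative (sumᴿ f)
sumᴿ-nonNegative {zero}  0≤f = nonNegative-0
sumᴿ-nonNegative {suc n} 0≤f = nonNegative-+ (0≤f zero) (sumᴿ-nonNegative (λ i → 0≤f (suc i)))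

-- From x + y = 0 the number -x equals y, so both x and -x are nonnegative.
+≈0⇒≈0ˡ : ∀ {x y} → NonNegative x → NonNegative y → x +ᴿ y ≈ᴿ 0ᴿ → x ≈ᴿ 0ᴿ
+≈0⇒≈0ˡ {x} {y} 0≤x 0≤y x+y≈0 = nonNegative-antisym 0≤x (nonNegative-resp y≈-x 0≤y)
  where
  open CommutativeRing ℝ-ring using (setoid; +-congʳ)
  open ℝ-Solver
  open ≈-Reasoning setoid
  y≈-x : y ≈ᴿ -ᴿ x
  y≈-x = begin
    y                 ≈⟨ solve 2 (λ x y → y := x :+ y :+ :- x) ≈ᴿ-refl x y ⟩
    x +ᴿ y +ᴿ -ᴿ x    ≈⟨ +-congʳ x+y≈0 ⟩
    0ᴿ +ᴿ -ᴿ x        ≈⟨ +ᴿ-identityˡ (-ᴿ x) ⟩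
    -ᴿ x              ∎

+≈0⇒≈0ʳ : ∀ {x y} → NonNegative x → NonNegative y → x +ᴿ y ≈ᴿ 0ᴿ → y ≈ᴿ 0ᴿ
+≈0⇒≈0ʳ {x} {y} 0≤x 0≤y x+y≈0 = +≈0⇒≈0ˡ 0≤y 0≤x (≈ᴿ-trans (+ᴿ-comm y x) x+y≈0)

-- This makes the norm definite: a state of norm 0 has every amplitude 0.
sumᴿ≈0⇒≈0 : ∀ {n} {f : Fin n → ℝ} → (∀ i → NonNegative (f i)) → sumᴿ f ≈ᴿ 0ᴿ → ∀ i → f i ≈ᴿ 0ᴿ
sumᴿ≈0⇒≈0 0≤f ∑f≈0 zero    = +≈0⇒≈0ˡ (0≤f zero) (sumᴿ-nonNegative (λ i → 0≤f (suc i))) ∑f≈0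
sumᴿ≈0⇒≈0 0≤f ∑f≈0 (suc i) = sumᴿ≈0⇒≈0 (λ i → 0≤f (suc i))
  (+≈0⇒≈0ʳ (0≤f zero) (sumᴿ-nonNegative (λ i → 0≤f (suc i))) ∑f≈0) i

-- Linear algebra over a ring with involution

-- Everything that does not involve the order on the scalars is done over an abstract ring with
-- involution: there scalars are neutral terms, whereas in ℂ every product unfolds into components.
module LinearAlgebra {c ℓ} (R : CommutativeRing c ℓ) where
  open CommutativeRing R hiding (zero) renaming (Carrier to K)
  open SemiringSum semiring using (sum; sum-cong-≋; sum-replicate-zero; *-distribˡ-sum; *-distribʳ-sum)
    renaming (∑-distrib-+ to sum-distrib-+; ∑-comm to sum-comm)
  open AbelianGroupProperties +-abelianGroup using (ε⁻¹≈ε; ⁻¹-∙-comm; inverseʳ-unique)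
  open RingProperties ring using (-‿distribʳ-*; -‿distribˡ-*)
  open ≈-Reasoning setoid

  sum-select : ∀ {n} (i : Fin n) (f : Fin n → K) →
               sum (λ k → if does (i Fin.≟ k) then f k else 0#) ≈ f i
  sum-select {suc n} zero    f = trans (+-congˡ (sum-replicate-zero n)) (+-identityʳ (f zero))
  sum-select {suc n} (suc i) f = trans (+-identityˡ _) (sum-select i (λ k → f (suc k)))

  sum-homo : ∀ {φ : K → K} → φ 0# ≈ 0# → (∀ x y → φ (x + y) ≈ φ x + φ y) →
             ∀ {n} (f : Fin n → K) → φ (sum f) ≈ sum (λ i → φ (f i))
  sum-homo φ-0 φ-+ {zero}  f = φ-0
  sum-homo φ-0 φ-+ {suc n} f = trans (φ-+ _ _) (+-congˡ (sum-homo φ-0 φ-+ (λ i → f (suc i))))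

  module Operators
    (conj : K → K) (conj-cong : ∀ {x y} → x ≈ y → conj x ≈ conj y) (conj-0 : conj 0# ≈ 0#)
    (conj-+ : ∀ x y → conj (x + y) ≈ conj x + conj y) (conj-* : ∀ x y → conj (x * y) ≈ conj x * conj y)
    (conj-involutive : ∀ x → conj (conj x) ≈ x)
    (k m : ℕ) where

    Index : Set
    Index = Fin k × Fin m

    Vector : Set c
    Vector = Index → K

    Matrix : Set c
    Matrix = Index → Index → K

    private
      variable
        u v w : Vector
        U V : Matrix

    infix 4 _≈ᵛ_ _≈ᵐ_
    infixr 7 _▹_
    infixl 7 _∙_
    infixl 6 _+ᵐ_
    infix 9 _⋆

    _≈ᵛ_ : Vector → Vector → Set ℓ
    v ≈ᵛ w = ∀ a → v a ≈ w a

    _≈ᵐ_ : Matrix → Matrix → Set ℓ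
    U ≈ᵐ V = ∀ a b → U a b ≈ V a b

    ∑ : Vector → K
    ∑ v = sum (λ i → sum (λ j → v (i , j)))

    _▹_ : Matrix → Vector → Vector
    (U ▹ v) a = ∑ (λ b → U a b * v b)

    _∙_ : Matrix → Matrix → Matrix
    (U ∙ V) a c = ∑ (λ b → U a b * V b c)

    _⋆ : Matrix → Matrix
    (U ⋆) a b = conj (U b a)

    I : Matrix
    I (i , j) (i′ , j′) = if does (i Fin.≟ i′) ∧ does (j Fin.≟ j′) then 1# else 0#

    _+ᵐ_ : Matrix → Matrix → Matrix
    (U +ᵐ V) a b = U a b + V a b

    0ᵛ : Vector
    0ᵛ _ = 0#

    ⟨_∣_⟩ : Vector → Vector → K
    ⟨ u ∣ v ⟩ = ∑ (λ a → conj (u a) * v a)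

    ∑-cong : v ≈ᵛ w → ∑ v ≈ ∑ w
    ∑-cong v≈w = sum-cong-≋ λ i → sum-cong-≋ λ j → v≈w (i , j)

    ∑-zero : ∑ 0ᵛ ≈ 0#
    ∑-zero = trans (sum-cong-≋ {k} λ _ → sum-replicate-zero m) (sum-replicate-zero k)

    ∑-+ : ∀ v w → ∑ (λ a → v a + w a) ≈ ∑ v + ∑ w
    ∑-+ v w = trans
      (sum-cong-≋ λ i → sum-distrib-+ (λ j → v (i , j)) (λ j → w (i , j)))
      (sum-distrib-+ (λ i → sum λ j → v (i , j)) (λ i → sum λ j → w (i , j)))

    *-distribˡ-∑ : ∀ z v → z * ∑ v ≈ ∑ (λ a → z * v a)
    *-distribˡ-∑ z v = trans (*-distribˡ-sum z (λ i → sum λ j → v (i , j)))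
      (sum-cong-≋ λ i → *-distribˡ-sum z (λ j → v (i , j)))

    *-distribʳ-∑ : ∀ z v → ∑ v * z ≈ ∑ (λ a → v a * z)
    *-distribʳ-∑ z v = trans (*-distribʳ-sum z (λ i → sum λ j → v (i , j)))
      (sum-cong-≋ λ i → *-distribʳ-sum z (λ j → v (i , j)))

    ∑-homo : ∀ {φ : K → K} → φ 0# ≈ 0# → (∀ x y → φ (x + y) ≈ φ x + φ y) →
             ∀ v → φ (∑ v) ≈ ∑ (λ a → φ (v a))
    ∑-homo φ-0 φ-+ v = trans (sum-homo φ-0 φ-+ (λ i → sum λ j → v (i , j)))
      (sum-cong-≋ λ i → sum-homo φ-0 φ-+ (λ j → v (i , j)))

    conj-∑ : ∀ v → conj (∑ v) ≈ ∑ (λ a → conj (v a))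
    conj-∑ = ∑-homo conj-0 conj-+

    -‿∑ : ∀ v → - ∑ v ≈ ∑ (λ a → - v a)
    -‿∑ = ∑-homo ε⁻¹≈ε (λ x y → sym (⁻¹-∙-comm x y))

    ∑-sum-comm : ∀ {l} (F : Index → Fin l → K) →
      ∑ (λ a → sum (F a)) ≈ sum (λ p → ∑ (λ a → F a p))
    ∑-sum-comm F = trans
      (sum-cong-≋ λ i → sum-comm (λ j → F (i , j)))
      (sum-comm (λ i p → sum λ j → F (i , j) p))

    ∑-comm : ∀ (F : Index → Index → K) →
      ∑ (λ a → ∑ (F a)) ≈ ∑ (λ b → ∑ (λ a → F a b))
    ∑-comm F = trans
      (∑-sum-comm (λ a i → sum λ j → F a (i , j)))
      (sum-cong-≋ λ i → ∑-sum-comm (λ a j → F a (i , j)))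

    mask : Index → Vector → Vector
    mask (i , j) v (i′ , j′) = if does (i Fin.≟ i′) ∧ does (j Fin.≟ j′) then v (i′ , j′) else 0#

    ∑-select : ∀ a v → ∑ (mask a v) ≈ v a
    ∑-select (i , j) v = trans (sum-cong-≋ {k} row) (sum-select i (λ i′ → v (i′ , j)))
      where
      row : ∀ i′ → sum (λ j′ → mask (i , j) v (i′ , j′)) ≈ (if does (i Fin.≟ i′) then v (i′ , j) else 0#)
      row i′ with does (i Fin.≟ i′)
      ... | true  = sum-select j (λ j′ → v (i′ , j′))
      ... | false = sum-replicate-zero m

    ▹-cong : U ≈ᵐ V → v ≈ᵛ w → U ▹ v ≈ᵛ V ▹ w
    ▹-cong U≈V v≈w a = ∑-cong λ b → *-cong (U≈V a b) (v≈w b)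

    ▹-congˡ : v ≈ᵛ w → U ▹ v ≈ᵛ U ▹ w
    ▹-congˡ = ▹-cong (λ _ _ → refl)

    ▹-congʳ : U ≈ᵐ V → U ▹ v ≈ᵛ V ▹ v
    ▹-congʳ U≈V = ▹-cong U≈V (λ _ → refl)

    ∙-▹ : ∀ U V v → (U ∙ V) ▹ v ≈ᵛ U ▹ (V ▹ v)
    ∙-▹ U V v a = begin
      ∑ (λ c → ∑ (λ b → U a b * V b c) * v c)
        ≈⟨ ∑-cong (λ c → *-distribʳ-∑ (v c) (λ b → U a b * V b c)) ⟩
      ∑ (λ c → ∑ (λ b → U a b * V b c * v c))
        ≈⟨ ∑-comm (λ c b → U a b * V b c * v c) ⟩
      ∑ (λ b → ∑ (λ c → U a b * V b c * v c))
        ≈⟨ ∑-cong (λ b → ∑-cong λ c → *-assoc (U a b) (V b c) (v c)) ⟩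
      ∑ (λ b → ∑ (λ c → U a b * (V b c * v c)))
        ≈⟨ ∑-cong (λ b → *-distribˡ-∑ (U a b) (λ c → V b c * v c)) ⟨
      ∑ (λ b → U a b * ∑ (λ c → V b c * v c)) ∎

    I-▹ : ∀ v → I ▹ v ≈ᵛ v
    I-▹ v a = trans (∑-cong (I-entry a)) (∑-select a v)
      where
      I-entry : ∀ a b → I a b * v b ≈ mask a v b
      I-entry (i , j) (i′ , j′) with does (i Fin.≟ i′) ∧ does (j Fin.≟ j′)
      ... | true  = *-identityˡ (v (i′ , j′))
      ... | false = zeroˡ (v (i′ , j′))

    +-▹ : ∀ U V v a → ((U +ᵐ V) ▹ v) a ≈ (U ▹ v) a + (V ▹ v) a
    +-▹ U V v a = trans
      (∑-cong λ b → distribʳ (v b) (U a b) (V a b))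
      (∑-+ (λ b → U a b * v b) (λ b → V a b * v b))

    inner-cong : ∀ {u u′ v v′} → u ≈ᵛ u′ → v ≈ᵛ v′ → ⟨ u ∣ v ⟩ ≈ ⟨ u′ ∣ v′ ⟩
    inner-cong u≈u′ v≈v′ = ∑-cong λ a → *-cong (conj-cong (u≈u′ a)) (v≈v′ a)

    inner-congʳ : ∀ {u v v′} → v ≈ᵛ v′ → ⟨ u ∣ v ⟩ ≈ ⟨ u ∣ v′ ⟩
    inner-congʳ = inner-cong (λ _ → refl)

    inner-zeroˡ : u ≈ᵛ 0ᵛ → ∀ v → ⟨ u ∣ v ⟩ ≈ 0#
    inner-zeroˡ u≈0 v = trans
      (∑-cong λ a → trans (*-congʳ (trans (conj-cong (u≈0 a)) conj-0)) (zeroˡ (v a)))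
      ∑-zero

    inner-zeroʳ : ∀ u → v ≈ᵛ 0ᵛ → ⟨ u ∣ v ⟩ ≈ 0#
    inner-zeroʳ u v≈0 = trans
      (∑-cong λ a → trans (*-congˡ (v≈0 a)) (zeroʳ (conj (u a))))
      ∑-zero

    inner-+ʳ : ∀ u v w → ⟨ u ∣ (λ a → v a + w a) ⟩ ≈ ⟨ u ∣ v ⟩ + ⟨ u ∣ w ⟩
    inner-+ʳ u v w = trans
      (∑-cong λ a → distribˡ (conj (u a)) (v a) (w a))
      (∑-+ (λ a → conj (u a) * v a) (λ a → conj (u a) * w a))

    inner-adjoint : ∀ U u v → ⟨ U ▹ u ∣ v ⟩ ≈ ⟨ u ∣ U ⋆ ▹ v ⟩
    inner-adjoint U u v = begin
      ∑ (λ a → conj (∑ (λ b → U a b * u b)) * v a)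
        ≈⟨ ∑-cong (λ a → *-congʳ (conj-∑ (λ b → U a b * u b))) ⟩
      ∑ (λ a → ∑ (λ b → conj (U a b * u b)) * v a)
        ≈⟨ ∑-cong (λ a → *-distribʳ-∑ (v a) (λ b → conj (U a b * u b))) ⟩
      ∑ (λ a → ∑ (λ b → conj (U a b * u b) * v a))
        ≈⟨ ∑-comm (λ a b → conj (U a b * u b) * v a) ⟩
      ∑ (λ b → ∑ (λ a → conj (U a b * u b) * v a))
        ≈⟨ ∑-cong (λ b → ∑-cong λ a → rearrange (U a b) (u b) (v a)) ⟩
      ∑ (λ b → ∑ (λ a → conj (u b) * (conj (U a b) * v a)))
        ≈⟨ ∑-cong (λ b → *-distribˡ-∑ (conj (u b)) (λ a → conj (U a b) * v a)) ⟨
      ∑ (λ b → conj (u b) * ∑ (λ a → conj (U a b) * v a)) ∎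
      where
      rearrange : ∀ x y z → conj (x * y) * z ≈ conj y * (conj x * z)
      rearrange x y z = begin
        conj (x * y) * z          ≈⟨ *-congʳ (conj-* x y) ⟩
        conj x * conj y * z       ≈⟨ *-congʳ (*-comm (conj x) (conj y)) ⟩
        conj y * conj x * z       ≈⟨ *-assoc (conj y) (conj x) z ⟩
        conj y * (conj x * z)     ∎

    inner-isometry : ∀ U → U ⋆ ∙ U ≈ᵐ I → ∀ u v → ⟨ U ▹ u ∣ U ▹ v ⟩ ≈ ⟨ u ∣ v ⟩
    inner-isometry U U⋆U≈I u v = begin
      ⟨ U ▹ u ∣ U ▹ v ⟩          ≈⟨ inner-adjoint U u (U ▹ v) ⟩
      ⟨ u ∣ U ⋆ ▹ (U ▹ v) ⟩      ≈⟨ inner-congʳ (∙-▹ (U ⋆) U v) ⟨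
      ⟨ u ∣ (U ⋆ ∙ U) ▹ v ⟩      ≈⟨ inner-congʳ (▹-congʳ U⋆U≈I) ⟩
      ⟨ u ∣ I ▹ v ⟩              ≈⟨ inner-congʳ (I-▹ v) ⟩
      ⟨ u ∣ v ⟩                  ∎

    complete-▹ : U +ᵐ V ≈ᵐ I → ∀ v a → v a ≈ (U ▹ v) a + (V ▹ v) a
    complete-▹ {U} {V} U+V≈I v a = begin
      v a                        ≈⟨ I-▹ v a ⟨
      (I ▹ v) a                  ≈⟨ ▹-congʳ U+V≈I a ⟨
      ((U +ᵐ V) ▹ v) a           ≈⟨ +-▹ U V v a ⟩
      (U ▹ v) a + (V ▹ v) a      ∎

    inner-complete : U +ᵐ V ≈ᵐ I → ∀ u v → ⟨ u ∣ v ⟩ ≈ ⟨ u ∣ U ▹ v ⟩ + ⟨ u ∣ V ▹ v ⟩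
    inner-complete {U} {V} U+V≈I u v = trans (inner-congʳ (complete-▹ U+V≈I v))
      (inner-+ʳ u (U ▹ v) (V ▹ v))

    inner-selfAdjoint : U ⋆ ≈ᵐ U → ∀ u v → ⟨ U ▹ u ∣ v ⟩ ≈ ⟨ u ∣ U ▹ v ⟩
    inner-selfAdjoint {U} U⋆≈U u v = trans (inner-adjoint U u v) (inner-congʳ (▹-congʳ U⋆≈U))

    inner-projection : U ⋆ ≈ᵐ U → U ∙ U ≈ᵐ U → ∀ v → ⟨ U ▹ v ∣ U ▹ v ⟩ ≈ ⟨ v ∣ U ▹ v ⟩
    inner-projection {U} U⋆≈U UU≈U v = begin
      ⟨ U ▹ v ∣ U ▹ v ⟩       ≈⟨ inner-selfAdjoint U⋆≈U v (U ▹ v) ⟩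
      ⟨ v ∣ U ▹ (U ▹ v) ⟩     ≈⟨ inner-congʳ (∙-▹ U U v) ⟨
      ⟨ v ∣ (U ∙ U) ▹ v ⟩     ≈⟨ inner-congʳ (▹-congʳ UU≈U) ⟩
      ⟨ v ∣ U ▹ v ⟩           ∎

    -- Pythagoras for the two outcomes. Inserting U + V = I once, on the right, leaves ⟨v∣Uv⟩ +
    -- ⟨v∣Vv⟩, and each term is a squared norm because the operator is a self-adjoint idempotent.
    inner-measurement : U ⋆ ≈ᵐ U → U ∙ U ≈ᵐ U → V ⋆ ≈ᵐ V → V ∙ V ≈ᵐ V → U +ᵐ V ≈ᵐ I →
      ∀ v → ⟨ v ∣ v ⟩ ≈ ⟨ U ▹ v ∣ U ▹ v ⟩ + ⟨ V ▹ v ∣ V ▹ v ⟩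
    inner-measurement U⋆≈U UU≈U V⋆≈V VV≈V U+V≈I v = trans (inner-complete U+V≈I v v)
      (sym (+-cong (inner-projection U⋆≈U UU≈U v) (inner-projection V⋆≈V VV≈V v)))

    -- Insert U + V = I between u and v. The U term dies on v; in the V term, self-adjointness moves
    -- V to the left, where it kills u.
    measurement-orthogonal : V ⋆ ≈ᵐ V → U +ᵐ V ≈ᵐ I →
      ∀ {u v} → V ▹ u ≈ᵛ 0ᵛ → U ▹ v ≈ᵛ 0ᵛ → ⟨ u ∣ v ⟩ ≈ 0#
    measurement-orthogonal {V} {U} V⋆≈V U+V≈I {u} {v} Vu≈0 Uv≈0 = begin
      ⟨ u ∣ v ⟩
        ≈⟨ inner-complete U+V≈I u v ⟩
      ⟨ u ∣ U ▹ v ⟩ + ⟨ u ∣ V ▹ v ⟩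
        ≈⟨ +-cong (inner-zeroʳ u Uv≈0) (trans (sym (inner-selfAdjoint V⋆≈V u v)) (inner-zeroˡ Vu≈0 v)) ⟩
      0# + 0#
        ≈⟨ +-identityˡ 0# ⟩
      0# ∎

    -- Complementary and rank-one projections

    infixl 6 _-ᵐ_
    _-ᵐ_ : Matrix → Matrix → Matrix
    (U -ᵐ V) a b = U a b - V a b

    ∑-minus : ∀ v w → ∑ (λ a → v a - w a) ≈ ∑ v - ∑ w
    ∑-minus v w = trans (∑-+ v (λ a → - w a)) (+-congˡ (sym (-‿∑ w)))

    -ᵐ-▹ : ∀ U V v a → ((U -ᵐ V) ▹ v) a ≈ (U ▹ v) a - (V ▹ v) a
    -ᵐ-▹ U V v a = trans
      (∑-cong λ b → trans (distribʳ (v b) (U a b) (- V a b)) (+-congˡ (sym (-‿distribˡ-* (V a b) (v b)))))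
      (∑-minus (λ b → U a b * v b) (λ b → V a b * v b))

    -ᵐ-∙ : ∀ U V W → (U -ᵐ V) ∙ W ≈ᵐ U ∙ W -ᵐ V ∙ W
    -ᵐ-∙ U V W a c = -ᵐ-▹ U V (λ b → W b c) a

    ∙--ᵐ : ∀ U V W → U ∙ (V -ᵐ W) ≈ᵐ U ∙ V -ᵐ U ∙ W
    ∙--ᵐ U V W a c = trans
      (∑-cong λ b → trans (distribˡ (U a b) (V b c) (- W b c)) (+-congˡ (sym (-‿distribʳ-* (U a b) (W b c)))))
      (∑-minus (λ b → U a b * V b c) (λ b → U a b * W b c))

    I-sym : ∀ a b → I a b ≡ I b a
    I-sym (i , j) (i′ , j′) = cong₂ (λ p q → if p ∧ q then 1# else 0#) (≟-sym i i′) (≟-sym j j′)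
      where
      ≟-sym : ∀ {n} (x y : Fin n) → does (x Fin.≟ y) ≡ does (y Fin.≟ x)
      ≟-sym x y = does-⇔ (mk⇔ ≡.sym ≡.sym) (x Fin.≟ y) (y Fin.≟ x)

    I-∙ : ∀ U → I ∙ U ≈ᵐ U
    I-∙ U a c = I-▹ (λ b → U b c) a

    ∙-I : ∀ U → U ∙ I ≈ᵐ U
    ∙-I U a c = trans
      (∑-cong λ b → trans (*-comm (U a b) (I b c)) (*-congʳ (reflexive (I-sym b c))))
      (I-▹ (U a) c)

    -- It follows from multiplicativity and involutivity: conj 1 = conj 1 * conj (conj 1) = conj (1
    -- * conj 1) = conj (conj 1) = 1.
    conj-1 : conj 1# ≈ 1#
    conj-1 = begin
      conj 1#                   ≈⟨ *-identityʳ (conj 1#) ⟨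
      conj 1# * 1#              ≈⟨ *-congˡ (conj-involutive 1#) ⟨
      conj 1# * conj (conj 1#)  ≈⟨ conj-* 1# (conj 1#) ⟨
      conj (1# * conj 1#)       ≈⟨ conj-cong (*-identityˡ (conj 1#)) ⟩
      conj (conj 1#)            ≈⟨ conj-involutive 1# ⟩
      1#                        ∎

    conj-neg : ∀ x → conj (- x) ≈ - conj x
    conj-neg x = inverseʳ-unique (conj x) (conj (- x))
      (trans (sym (conj-+ x (- x))) (trans (conj-cong (-‿inverseʳ x)) conj-0))

    I⋆≈I : I ⋆ ≈ᵐ I
    I⋆≈I a b = trans (conj-cong (reflexive (I-sym b a))) (conj-I a b)
      where
      conj-I : ∀ a b → conj (I a b) ≈ I a b
      conj-I (i , j) (i′ , j′) with does (i Fin.≟ i′) ∧ does (j Fin.≟ j′)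
      ... | true  = conj-1
      ... | false = conj-0

    I-isometry : I ⋆ ∙ I ≈ᵐ I
    I-isometry a b = trans (∙-I (I ⋆) a b) (I⋆≈I a b)

    I-coisometry : I ∙ I ⋆ ≈ᵐ I
    I-coisometry a b = trans (I-∙ (I ⋆) a b) (I⋆≈I a b)

    module Complement (U : Matrix) (U⋆≈U : U ⋆ ≈ᵐ U) (UU≈U : U ∙ U ≈ᵐ U) where

      complement : Matrix
      complement = I -ᵐ U

      complement-selfAdjoint : complement ⋆ ≈ᵐ complement
      complement-selfAdjoint a b = trans (conj-+ (I b a) (- U b a))
        (+-cong (I⋆≈I a b) (trans (conj-neg (U b a)) (-‿cong (U⋆≈U a b))))

      orthogonalʳ : ∀ a b → (U ∙ complement) a b ≈ 0#
      orthogonalʳ a b = trans (∙--ᵐ U I U a b)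
        (trans (+-cong (∙-I U a b) (-‿cong (UU≈U a b))) (-‿inverseʳ (U a b)))

      orthogonalˡ : ∀ a b → (complement ∙ U) a b ≈ 0#
      orthogonalˡ a b = trans (-ᵐ-∙ I U U a b)
        (trans (+-cong (I-∙ U a b) (-‿cong (UU≈U a b))) (-‿inverseʳ (U a b)))

      complement-idempotent : complement ∙ complement ≈ᵐ complement
      complement-idempotent a b = begin
        (complement ∙ complement) a b                          ≈⟨ ∙--ᵐ complement I U a b ⟩
        (complement ∙ I) a b - (complement ∙ U) a b            ≈⟨ +-cong (∙-I complement a b) (-‿cong (orthogonalˡ a b)) ⟩
        complement a b - 0#                                    ≈⟨ +-congˡ ε⁻¹≈ε ⟩
        complement a b + 0#                                    ≈⟨ +-identityʳ (complement a b) ⟩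
        complement a b                                         ∎

      complement-complete : U +ᵐ complement ≈ᵐ I
      complement-complete a b = begin
        U a b + (I a b - U a b)        ≈⟨ +-comm (U a b) (I a b - U a b) ⟩
        I a b - U a b + U a b          ≈⟨ +-assoc (I a b) (- U a b) (U a b) ⟩
        I a b + (- U a b + U a b)      ≈⟨ +-congˡ (-‿inverseˡ (U a b)) ⟩
        I a b + 0#                     ≈⟨ +-identityʳ (I a b) ⟩
        I a b                          ∎

      ▹≈0⇒complement-fixes : ∀ {v} → U ▹ v ≈ᵛ 0ᵛ → complement ▹ v ≈ᵛ v
      ▹≈0⇒complement-fixes {v} Uv≈0 a = begin
        (complement ▹ v) a           ≈⟨ -ᵐ-▹ I U v a ⟩
        (I ▹ v) a - (U ▹ v) a        ≈⟨ +-cong (I-▹ v a) (-‿cong (Uv≈0 a)) ⟩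
        v a - 0#                     ≈⟨ +-congˡ ε⁻¹≈ε ⟩
        v a + 0#                     ≈⟨ +-identityʳ (v a) ⟩
        v a                          ∎

    module RankOne (ψ : Vector) (ψ-normalised : ⟨ ψ ∣ ψ ⟩ ≈ 1#) where

      -- The operator ∣ψ⟩⟨ψ∣ in coordinates.
      projector : Matrix
      projector a b = ψ a * conj (ψ b)

      projector-▹ : ∀ v a → (projector ▹ v) a ≈ ψ a * ⟨ ψ ∣ v ⟩
      projector-▹ v a = trans
        (∑-cong λ b → *-assoc (ψ a) (conj (ψ b)) (v b))
        (sym (*-distribˡ-∑ (ψ a) (λ b → conj (ψ b) * v b)))

      projector-fixes : ∀ c {v} → v ≈ᵛ (λ a → ψ a * c) → projector ▹ v ≈ᵛ v
      projector-fixes c {v} v≈ψc a = begin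
        (projector ▹ v) a                              ≈⟨ projector-▹ v a ⟩
        ψ a * ⟨ ψ ∣ v ⟩                                ≈⟨ *-congˡ (inner-congʳ v≈ψc) ⟩
        ψ a * ⟨ ψ ∣ (λ b → ψ b * c) ⟩                  ≈⟨ *-congˡ (∑-cong λ b → *-assoc (conj (ψ b)) (ψ b) c) ⟨
        ψ a * ∑ (λ b → conj (ψ b) * ψ b * c)           ≈⟨ *-congˡ (*-distribʳ-∑ c (λ b → conj (ψ b) * ψ b)) ⟨
        ψ a * (⟨ ψ ∣ ψ ⟩ * c)                          ≈⟨ *-congˡ (*-congʳ ψ-normalised) ⟩
        ψ a * (1# * c)                                 ≈⟨ *-congˡ (*-identityˡ c) ⟩
        ψ a * c                                        ≈⟨ v≈ψc a ⟨
        v a                                            ∎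

      projector-annihilates : ∀ {v} → ⟨ ψ ∣ v ⟩ ≈ 0# → projector ▹ v ≈ᵛ 0ᵛ
      projector-annihilates {v} ⟨ψ∣v⟩≈0 a = trans (projector-▹ v a) (trans (*-congˡ ⟨ψ∣v⟩≈0) (zeroʳ (ψ a)))

      projector-selfAdjoint : projector ⋆ ≈ᵐ projector
      projector-selfAdjoint a b = begin
        conj (ψ b * conj (ψ a))          ≈⟨ conj-* (ψ b) (conj (ψ a)) ⟩
        conj (ψ b) * conj (conj (ψ a))   ≈⟨ *-congˡ (conj-involutive (ψ a)) ⟩
        conj (ψ b) * ψ a                 ≈⟨ *-comm (conj (ψ b)) (ψ a) ⟩
        ψ a * conj (ψ b)                 ∎

      projector-idempotent : projector ∙ projector ≈ᵐ projector
      -- Every column of the projector is a multiple of ψ and is therefore fixed by it.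
      projector-idempotent a c = projector-fixes (conj (ψ c)) (λ _ → refl) a

      open Complement projector projector-selfAdjoint projector-idempotent public

-- Complex numbers

module _ where
  open ℝ-Solver

  *ᶜ-assoc : ∀ x y z → (x *ᶜ y) *ᶜ z ≈ᶜ x *ᶜ (y *ᶜ z)
  *ᶜ-assoc (a +i b) (c +i d) (e +i f) =
      solve 6 (λ a b c d e f →
        (a :* c :- b :* d) :* e :- (a :* d :+ b :* c) :* f :=
        a :* (c :* e :- d :* f) :- b :* (c :* f :+ d :* e)) ≈ᴿ-refl a b c d e f
    , solve 6 (λ a b c d e f →
        (a :* c :- b :* d) :* f :+ (a :* d :+ b :* c) :* e :=
        a :* (c :* f :+ d :* e) :+ b :* (c :* e :- d :* f)) ≈ᴿ-refl a b c d e f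

  *ᶜ-comm : ∀ x y → x *ᶜ y ≈ᶜ y *ᶜ x
  *ᶜ-comm (a +i b) (c +i d) =
      solve 4 (λ a b c d → a :* c :- b :* d := c :* a :- d :* b) ≈ᴿ-refl a b c d
    , solve 4 (λ a b c d → a :* d :+ b :* c := c :* b :+ d :* a) ≈ᴿ-refl a b c d

  *ᶜ-identityˡ : ∀ x → 1ᶜ *ᶜ x ≈ᶜ x
  *ᶜ-identityˡ (a +i b) =
      solve 2 (λ a b → con 1ℚ :* a :- con 0ℚ :* b := a) ≈ᴿ-refl a b
    , solve 2 (λ a b → con 1ℚ :* b :+ con 0ℚ :* a := b) ≈ᴿ-refl a b

  *ᶜ-distribˡ : ∀ x y z → x *ᶜ (y +ᶜ z) ≈ᶜ x *ᶜ y +ᶜ x *ᶜ z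
  *ᶜ-distribˡ (a +i b) (c +i d) (e +i f) =
      solve 6 (λ a b c d e f →
        a :* (c :+ e) :- b :* (d :+ f) := (a :* c :- b :* d) :+ (a :* e :- b :* f))
        ≈ᴿ-refl a b c d e f
    , solve 6 (λ a b c d e f →
        a :* (d :+ f) :+ b :* (c :+ e) := (a :* d :+ b :* c) :+ (a :* f :+ b :* e))
        ≈ᴿ-refl a b c d e f

≈ᶜ-trans : ∀ {x y z} → x ≈ᶜ y → y ≈ᶜ z → x ≈ᶜ z
≈ᶜ-trans (p , q) (r , s) = ≈ᴿ-trans p r , ≈ᴿ-trans q s

*ᶜ-cong : ∀ {x x′ y y′} → x ≈ᶜ x′ → y ≈ᶜ y′ → x *ᶜ y ≈ᶜ x′ *ᶜ y′
*ᶜ-cong (p , q) (r , s) =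
    +ᴿ-cong (*ᴿ-cong p r) (-ᴿ-cong (*ᴿ-cong q s))
  , +ᴿ-cong (*ᴿ-cong p s) (*ᴿ-cong q r)

ℂ-ring : CommutativeRing 0ℓ 0ℓ
ℂ-ring = record
  { Carrier = ℂ ; _≈_ = _≈ᶜ_ ; _+_ = _+ᶜ_ ; _*_ = _*ᶜ_ ; -_ = -ᶜ_ ; 0# = 0ᶜ ; 1# = 1ᶜ
  ; isCommutativeRing = record
    { isRing = record
      { +-isAbelianGroup = record
        { isGroup = record
          { isMonoid = record
            { isSemigroup = record
              { isMagma = record
                { isEquivalence = record
                  { refl = ≈ᴿ-refl , ≈ᴿ-refl
                  ; sym = λ (p , q) → ≈ᴿ-sym p , ≈ᴿ-sym q
                  ; trans = ≈ᶜ-trans }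
                ; ∙-cong = λ (p , q) (r , s) → +ᴿ-cong p r , +ᴿ-cong q s }
              ; assoc = λ x y z → +ᴿ-assoc (re x) (re y) (re z) , +ᴿ-assoc (im x) (im y) (im z) }
            ; identity = (λ x → +ᴿ-identityˡ (re x) , +ᴿ-identityˡ (im x))
                       , (λ x → +ᴿ-identityʳ (re x) , +ᴿ-identityʳ (im x)) }
          ; inverse = (λ x → -ᴿ-inverseˡ (re x) , -ᴿ-inverseˡ (im x))
                    , (λ x → -ᴿ-inverseʳ (re x) , -ᴿ-inverseʳ (im x))
          ; ⁻¹-cong = λ (p , q) → -ᴿ-cong p , -ᴿ-cong q }
        ; comm = λ x y → +ᴿ-comm (re x) (re y) , +ᴿ-comm (im x) (im y) }
      ; *-cong = *ᶜ-cong
      ; *-assoc = *ᶜ-assoc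
      ; *-identity = *ᶜ-identityˡ , λ x → ≈ᶜ-trans (*ᶜ-comm x 1ᶜ) (*ᶜ-identityˡ x)
      ; distrib = *ᶜ-distribˡ , λ x y z → ≈ᶜ-trans (*ᶜ-comm (y +ᶜ z) x) (≈ᶜ-trans (*ᶜ-distribˡ x y z)
          (+ᶜ-cong (*ᶜ-comm x y) (*ᶜ-comm x z))) }
    ; *-comm = *ᶜ-comm } }
  where
  +ᶜ-cong : ∀ {x x′ y y′} → x ≈ᶜ x′ → y ≈ᶜ y′ → x +ᶜ y ≈ᶜ x′ +ᶜ y′
  +ᶜ-cong (p , q) (r , s) = +ᴿ-cong p r , +ᴿ-cong q s

module ℝR where
  open CommutativeRing ℝ-ring public
  open SemiringSum semiring public using (sum-cong-≋)

module ℂR where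
  open CommutativeRing ℂ-ring public
  open SemiringSum semiring public using (sum-cong-≋)

conj-cong : ∀ {z w} → z ≈ᶜ w → conj z ≈ᶜ conj w
conj-cong (p , q) = p , -ᴿ-cong q

conj-+ : ∀ z w → conj (z +ᶜ w) ≈ᶜ conj z +ᶜ conj w
conj-+ (a +i b) (c +i d) = ≈ᴿ-refl , solve 2 (λ b d → :- (b :+ d) := :- b :+ :- d) ≈ᴿ-refl b d
  where open ℝ-Solver

conj-0 : conj 0ᶜ ≈ᶜ 0ᶜ
conj-0 = ≈ᴿ-refl , solve 0 (:- con 0ℚ := con 0ℚ) ≈ᴿ-refl
  where open ℝ-Solver

conj-* : ∀ z w → conj (z *ᶜ w) ≈ᶜ conj z *ᶜ conj w
conj-* (a +i b) (c +i d) =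
    solve 4 (λ a b c d → a :* c :- b :* d := a :* c :- :- b :* :- d) ≈ᴿ-refl a b c d
  , solve 4 (λ a b c d → :- (a :* d :+ b :* c) := a :* :- d :+ :- b :* c) ≈ᴿ-refl a b c d
  where open ℝ-Solver

summand≈0 : ∀ {s p q} → s ≈ᴿ p +ᴿ q → s ≈ᴿ 1ᴿ → p ≈ᴿ 1ᴿ → q ≈ᴿ 0ᴿ
summand≈0 {s} {p} {q} s≈p+q s≈1 p≈1 = begin
  q               ≈⟨ solve 2 (λ p q → q := (p :+ q) :- p) ≈ᴿ-refl p q ⟩
  p +ᴿ q -ᴿ p     ≈⟨ +ᴿ-cong (≈ᴿ-trans (≈ᴿ-sym s≈p+q) s≈1) (-ᴿ-cong p≈1) ⟩
  1ᴿ -ᴿ 1ᴿ        ≈⟨ -ᴿ-inverseʳ 1ᴿ ⟩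
  0ᴿ              ∎
  where
  open ℝ-Solver
  open ≈-Reasoning ℝR.setoid

conj-involutive : ∀ z → conj (conj z) ≈ᶜ z
conj-involutive (a +i b) = ≈ᴿ-refl , solve 1 (λ b → :- :- b := b) ≈ᴿ-refl b
  where open ℝ-Solver

ι : ℝ → ℂ
ι x = x +i 0ᴿ

ι-sum : ∀ {n} (f : Fin n → ℝ) → sumᶜ (λ i → ι (f i)) ≈ᶜ ι (sumᴿ f)
ι-sum {zero}  f = ℂR.refl
ι-sum {suc n} f = ℂR.trans (ℂR.+-congˡ (ι-sum (λ i → f (suc i)))) (≈ᴿ-refl , +ᴿ-identityˡ 0ᴿ)

conj-*-self : ∀ z → conj z *ᶜ z ≈ᶜ ι ∣ z ∣²
conj-*-self (a +i b) =
    solve 2 (λ a b → a :* a :- :- b :* b := a :* a :+ b :* b) ≈ᴿ-refl a b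
  , solve 2 (λ a b → a :* b :+ :- b :* a := con 0ℚ) ≈ᴿ-refl a b
  where open ℝ-Solver

nonNegative-∣∣² : ∀ z → NonNegative ∣ z ∣²
nonNegative-∣∣² (a +i b) = nonNegative-+ (nonNegative-square a) (nonNegative-square b)

∣∣²≈0⇒≈0 : ∀ z → ∣ z ∣² ≈ᴿ 0ᴿ → z ≈ᶜ 0ᶜ
∣∣²≈0⇒≈0 (a +i b) a²+b²≈0 =
    square≈0⇒≈0 (+≈0⇒≈0ˡ (nonNegative-square a) (nonNegative-square b) a²+b²≈0)
  , square≈0⇒≈0 (+≈0⇒≈0ʳ (nonNegative-square a) (nonNegative-square b) a²+b²≈0)


module ℂLinear (n m : ℕ) =
  LinearAlgebra.Operators ℂ-ring conj conj-cong conj-0 conj-+ conj-* conj-involutive (suc n) m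

-- Queries and measurements

weight : ∀ {n m} → State n m → Fin (suc n) → ℝ
weight v i = sumᴿ (λ j → ∣ v (i , j) ∣²)

weight-nonNegative : ∀ {n m} (v : State n m) i → NonNegative (weight v i)
weight-nonNegative v i = sumᴿ-nonNegative (λ j → nonNegative-∣∣² (v (i , j)))

hamming : ∀ {n} → (Fin n → ℝ) → Vec Bool n → Vec Bool n → ℝ
hamming w x y = sumᴿ (λ i → if lookup x i xor lookup y i then w i else 0ᴿ)

signed : Bool → ℝ → ℝ
signed b x = if b then -ᴿ x else x

-- Query position 0 receives phase 1 for every input, so no two inputs differ there.
differs : ∀ {n} → Vec Bool n → Vec Bool n → Fin (suc n) → Bool
differs x y zero    = false
differs x y (suc i) = lookup x i xor lookup y i

module _ where
  open ℝ-Solver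

  -- Turning +w into -w lowers a sum by 2w. The doubling is written as an addition.
  sum-signed : ∀ {n} (b : Fin n → Bool) (w : Fin n → ℝ) →
    sumᴿ (λ i → signed (b i) (w i)) ≈ᴿ
    sumᴿ w -ᴿ (sumᴿ (λ i → if b i then w i else 0ᴿ) +ᴿ sumᴿ (λ i → if b i then w i else 0ᴿ))
  sum-signed {zero}  b w = solve 0 (con 0ℚ := con 0ℚ :- (con 0ℚ :+ con 0ℚ)) ≈ᴿ-refl
  sum-signed {suc n} b w = ≈ᴿ-trans (+ᴿ-cong ≈ᴿ-refl (sum-signed (λ i → b (suc i)) (λ i → w (suc i)))) (head (b zero))
    where
    s = sumᴿ (λ i → w (suc i))
    h = sumᴿ (λ i → if b (suc i) then w (suc i) else 0ᴿ)
    head : ∀ c → signed c (w zero) +ᴿ (s -ᴿ (h +ᴿ h)) ≈ᴿ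
                 w zero +ᴿ s -ᴿ ((if c then w zero else 0ᴿ) +ᴿ h +ᴿ ((if c then w zero else 0ᴿ) +ᴿ h))
    head true  = solve 3 (λ x s h → :- x :+ (s :- (h :+ h)) := x :+ s :- (x :+ h :+ (x :+ h))) ≈ᴿ-refl (w zero) s h
    head false = solve 3 (λ x s h → x :+ (s :- (h :+ h)) := x :+ s :- (con 0ℚ :+ h :+ (con 0ℚ :+ h))) ≈ᴿ-refl (w zero) s h

  sumᴿ-signed : ∀ {n} b (f : Fin n → ℝ) → sumᴿ (λ j → signed b (f j)) ≈ᴿ signed b (sumᴿ f)
  sumᴿ-signed {zero}  true  f = solve 0 (con 0ℚ := :- con 0ℚ) ≈ᴿ-refl
  sumᴿ-signed {suc n} true  f = ≈ᴿ-trans (+ᴿ-cong ≈ᴿ-refl (sumᴿ-signed true (λ j → f (suc j))))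
    (solve 2 (λ x y → :- x :+ :- y := :- (x :+ y)) ≈ᴿ-refl (f zero) (sumᴿ (λ j → f (suc j))))
  sumᴿ-signed         false f = ≈ᴿ-refl

  -- The phases are real, so they survive conjugation and multiply to the sign of their xor, leaving
  -- conj z * z.
  signs-* : ∀ s t z → conj ((if s then -ᶜ 1ᶜ else 1ᶜ) *ᶜ z) *ᶜ ((if t then -ᶜ 1ᶜ else 1ᶜ) *ᶜ z)
                      ≈ᶜ ι (signed (s xor t) ∣ z ∣²)
  signs-* s t z = ℂR.trans (ℂR.*-cong (conj-cong (sign-* s z)) (sign-* t z)) (cases s t z)
    where
    sign : Bool → ℂ → ℂ
    sign b z = if b then -ᶜ z else z
    sign-* : ∀ b z → (if b then -ᶜ 1ᶜ else 1ᶜ) *ᶜ z ≈ᶜ sign b z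
    sign-* true  z = RingProperties.-1*x≈-x (CommutativeRing.ring ℂ-ring) z
    sign-* false z = ℂR.*-identityˡ z
    cases : ∀ s t z → conj (sign s z) *ᶜ sign t z ≈ᶜ ι (signed (s xor t) ∣ z ∣²)
    cases true true (a +i b) =
        solve 2 (λ a b → :- a :* :- a :- :- :- b :* :- b := a :* a :+ b :* b) ≈ᴿ-refl a b
      , solve 2 (λ a b → :- a :* :- b :+ :- :- b :* :- a := con 0ℚ) ≈ᴿ-refl a b
    cases true false (a +i b) =
        solve 2 (λ a b → :- a :* a :- :- :- b :* b := :- (a :* a :+ b :* b)) ≈ᴿ-refl a b
      , solve 2 (λ a b → :- a :* b :+ :- :- b :* a := con 0ℚ) ≈ᴿ-refl a b
    cases false true (a +i b) =
        solve 2 (λ a b → a :* :- a :- :- b :* :- b := :- (a :* a :+ b :* b)) ≈ᴿ-refl a b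
      , solve 2 (λ a b → a :* :- b :+ :- b :* :- a := con 0ℚ) ≈ᴿ-refl a b
    cases false false z = conj-*-self z

  conj-phase-* : ∀ {n} (x y : Vec Bool n) i z →
    conj (phase x i *ᶜ z) *ᶜ (phase y i *ᶜ z) ≈ᶜ ι (signed (differs x y i) ∣ z ∣²)
  conj-phase-* x y zero    z = signs-* false false z
  conj-phase-* x y (suc i) z = signs-* (lookup x i) (lookup y i) z

hamming-self : ∀ {n} (w : Fin n → ℝ) x → hamming w x x ≈ᴿ 0ᴿ
hamming-self {zero}  w []      = ≈ᴿ-refl
hamming-self {suc n} w (b ∷ x) = ≈ᴿ-trans (+ᴿ-cong (same b) (hamming-self (λ i → w (suc i)) x)) (+ᴿ-identityˡ 0ᴿ)
  where
  same : ∀ b → (if b xor b then w zero else 0ᴿ) ≈ᴿ 0ᴿ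
  same true  = ≈ᴿ-refl
  same false = ≈ᴿ-refl

module _ {n m : ℕ} where
  open ℂLinear n m using (⟨_∣_⟩; _≈ᵛ_; 0ᵛ; inner-cong; inner-isometry; inner-measurement; measurement-orthogonal)

  inner-self : ∀ (v : State n m) → ⟨ v ∣ v ⟩ ≈ᶜ ι (normSq v)
  inner-self v = begin
    ⟨ v ∣ v ⟩
      ≈⟨ ℂR.sum-cong-≋ {suc n} (λ i → ℂR.sum-cong-≋ {m} (λ j → conj-*-self (v (i , j)))) ⟩
    sumᶜ {suc n} (λ i → sumᶜ {m} (λ j → ι ∣ v (i , j) ∣²))
      ≈⟨ ℂR.sum-cong-≋ {suc n} (λ i → ι-sum (λ j → ∣ v (i , j) ∣²)) ⟩
    sumᶜ {suc n} (λ i → ι (weight v i))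
      ≈⟨ ι-sum (weight v) ⟩
    ι (normSq v) ∎
    where open ≈-Reasoning ℂR.setoid

  inner≈⇒normSq≈ : ∀ (u v : State n m) → ⟨ u ∣ u ⟩ ≈ᶜ ⟨ v ∣ v ⟩ → normSq u ≈ᴿ normSq v
  inner≈⇒normSq≈ u v eq = proj₁ (ℂR.trans (ℂR.sym (inner-self u)) (ℂR.trans eq (inner-self v)))

  normSq-cong : ∀ {u v : State n m} → u ≈ᵛ v → normSq u ≈ᴿ normSq v
  normSq-cong {u} {v} u≈v = inner≈⇒normSq≈ u v (inner-cong {u} {v} {u} {v} u≈v u≈v)

  normSq-unitary : ∀ (U : Operator n m) → IsUnitary U → ∀ v → normSq (U ▷ v) ≈ᴿ normSq v
  normSq-unitary U (U†U≈𝟙 , _) v = inner≈⇒normSq≈ (U ▷ v) v (inner-isometry U U†U≈𝟙 v v)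

  normSq≈0⇒≈0 : ∀ (v : State n m) → normSq v ≈ᴿ 0ᴿ → v ≈ᵛ 0ᵛ
  normSq≈0⇒≈0 v ∥v∥²≈0 (i , j) = ∣∣²≈0⇒≈0 (v (i , j))
    (sumᴿ≈0⇒≈0 (λ j → nonNegative-∣∣² (v (i , j)))
      (sumᴿ≈0⇒≈0 {f = weight v} (weight-nonNegative v) ∥v∥²≈0 i) j)

  -- The oracle is diagonal with entries ±1, so the inner product is the sum of the position
  -- weights, taken with a minus sign exactly where x and y differ.
  inner-oracle : ∀ x y (v : State n m) → ⟨ oracle x v ∣ oracle y v ⟩ ≈ᶜ
    ι (normSq v -ᴿ (hamming (λ i → weight v (suc i)) x y +ᴿ hamming (λ i → weight v (suc i)) x y))
  inner-oracle x y v = begin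
    ⟨ oracle x v ∣ oracle y v ⟩
      ≈⟨ ℂR.sum-cong-≋ {suc n} (λ i → ℂR.sum-cong-≋ {m} (λ j → conj-phase-* x y i (v (i , j)))) ⟩
    sumᶜ {suc n} (λ i → sumᶜ {m} (λ j → ι (signed (differs x y i) ∣ v (i , j) ∣²)))
      ≈⟨ ℂR.sum-cong-≋ {suc n} (λ i → ι-sum (λ j → signed (differs x y i) ∣ v (i , j) ∣²)) ⟩
    sumᶜ {suc n} (λ i → ι (sumᴿ (λ j → signed (differs x y i) ∣ v (i , j) ∣²)))
      ≈⟨ ι-sum (λ i → sumᴿ (λ j → signed (differs x y i) ∣ v (i , j) ∣²)) ⟩
    ι (sumᴿ {suc n} (λ i → sumᴿ (λ j → signed (differs x y i) ∣ v (i , j) ∣²)))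
      ≈⟨ ≈ᴿ-trans (ℝR.sum-cong-≋ {suc n} (λ i → sumᴿ-signed (differs x y i) (λ j → ∣ v (i , j) ∣²)))
           (≈ᴿ-trans (sum-signed (differs x y) (weight v)) drop-zero) , ≈ᴿ-refl ⟩
    ι (normSq v -ᴿ (h +ᴿ h)) ∎
    where
    open ≈-Reasoning ℂR.setoid
    h = hamming (λ i → weight v (suc i)) x y
    drop-zero : normSq v -ᴿ ((0ᴿ +ᴿ h) +ᴿ (0ᴿ +ᴿ h)) ≈ᴿ normSq v -ᴿ (h +ᴿ h)
    drop-zero = +ᴿ-cong ≈ᴿ-refl (-ᴿ-cong (+ᴿ-cong (+ᴿ-identityˡ h) (+ᴿ-identityˡ h)))

  normSq-oracle : ∀ x (v : State n m) → normSq (oracle x v) ≈ᴿ normSq v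
  normSq-oracle x v = begin
    normSq (oracle x v)            ≈⟨ proj₁ (ℂR.trans (ℂR.sym (inner-self (oracle x v))) (inner-oracle x x v)) ⟩
    normSq v -ᴿ (h +ᴿ h)           ≈⟨ +ᴿ-cong ≈ᴿ-refl (-ᴿ-cong (+ᴿ-cong h≈0 h≈0)) ⟩
    normSq v -ᴿ (0ᴿ +ᴿ 0ᴿ)         ≈⟨ solve 1 (λ a → a :- (con 0ℚ :+ con 0ℚ) := a) ≈ᴿ-refl (normSq v) ⟩
    normSq v                       ∎
    where
    open ≈-Reasoning ℝR.setoid
    open ℝ-Solver
    h = hamming (λ i → weight v (suc i)) x x
    h≈0 = hamming-self (λ i → weight v (suc i)) x

  module _ {P : Bool → Operator n m} (P-measurement : IsProjectiveMeasurement P) where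
    open IsProjectiveMeasurement P-measurement

    complete-not : ∀ b → P b +ᴼ P (not b) ≈ᴼ 𝟙
    complete-not false a c = complete a c
    complete-not true  a c = ℂR.trans (ℂR.+-comm (P true a c) (P false a c)) (complete a c)

    normSq-split : ∀ b v → normSq v ≈ᴿ normSq (P b ▷ v) +ᴿ normSq (P (not b) ▷ v)
    normSq-split b v = proj₁ (begin
      ι (normSq v)
        ≈⟨ inner-self v ⟨
      ⟨ v ∣ v ⟩
        ≈⟨ inner-measurement {P b} {P (not b)} (selfAdjoint b) (idempotent b)
             (selfAdjoint (not b)) (idempotent (not b)) (complete-not b) v ⟩
      ⟨ P b ▷ v ∣ P b ▷ v ⟩ +ᶜ ⟨ P (not b) ▷ v ∣ P (not b) ▷ v ⟩
        ≈⟨ ℂR.+-cong (inner-self (P b ▷ v)) (inner-self (P (not b) ▷ v)) ⟩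
      ι (normSq (P b ▷ v)) +ᶜ ι (normSq (P (not b) ▷ v)) ∎)
      where open ≈-Reasoning ℂR.setoid

    -- The two outcome probabilities add up to 1, so the other one is 0, and a state of norm 0 is
    -- zero.
    certain⇒complement-vanishes : ∀ b v → normSq v ≈ᴿ 1ᴿ → normSq (P b ▷ v) ≈ᴿ 1ᴿ → P (not b) ▷ v ≈ᵛ 0ᵛ
    certain⇒complement-vanishes b v ∥v∥²≈1 ∥Pv∥²≈1 =
      normSq≈0⇒≈0 (P (not b) ▷ v) (summand≈0 (normSq-split b v) ∥v∥²≈1 ∥Pv∥²≈1)

    certain-distinct⇒orthogonal : ∀ b u v → normSq u ≈ᴿ 1ᴿ → normSq v ≈ᴿ 1ᴿ →
      normSq (P b ▷ u) ≈ᴿ 1ᴿ → normSq (P (not b) ▷ v) ≈ᴿ 1ᴿ → ⟨ u ∣ v ⟩ ≈ᶜ 0ᶜ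
    certain-distinct⇒orthogonal b u v ∥u∥²≈1 ∥v∥²≈1 ∥Pu∥²≈1 ∥Pv∥²≈1 =
      measurement-orthogonal {P (not b)} {P b} (selfAdjoint (not b)) (complete-not b) {u} {v}
        (certain⇒complement-vanishes b u ∥u∥²≈1 ∥Pu∥²≈1)
        (subst (λ c → P c ▷ v ≈ᵛ 0ᵛ) (not-involutive b)
          (certain⇒complement-vanishes (not b) v ∥v∥²≈1 ∥Pv∥²≈1))

-- Bit weights of an exact algorithm

Conflict : ∀ {n} → PartialBoolFun n → Vec Bool n → Vec Bool n → Set
Conflict f x y = Σ[ x∈D ∈ T (domain f x) ] Σ[ y∈D ∈ T (domain f y) ] value f x x∈D ≢ value f y y∈D

-- The interface between the quantum and the combinatorial half of the argument; no operator or
-- state is mentioned beyond this point of the forward direction.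
HalvingWeights : ∀ {n} → PartialBoolFun n → Set
HalvingWeights {n} f = Σ[ w ∈ (Fin n → ℝ) ] (∀ i → NonNegative (w i)) × NonNegative (1ᴿ -ᴿ sumᴿ w) ×
  (∀ {x y} → Conflict f x y → hamming w x y ≈ᴿ fromℚ ½)

exact⇒halvingWeights : ∀ {n} {f : PartialBoolFun n} → ExactlyOneQueryComputable f → HalvingWeights f
exact⇒halvingWeights {n} {f} (A , A-computes-f) = w , w-nonNegative , 0≤1-∑w , conflict⇒½
  where
  open OneQueryAlgorithm A
  open ℂLinear n m using (⟨_∣_⟩; inner-isometry)
  open ℝ-Solver
  open ≈-Reasoning ℝR.setoid

  φ : State n m
  φ = U₀ ▷ ψ₀

  w : Fin n → ℝ
  w i = weight φ (suc i)

  w-nonNegative : ∀ i → NonNegative (w i)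
  w-nonNegative i = weight-nonNegative φ (suc i)

  ∥φ∥²≈1 : normSq φ ≈ᴿ 1ᴿ
  ∥φ∥²≈1 = ≈ᴿ-trans (normSq-unitary U₀ U₀-unitary ψ₀) ψ₀-normalised

  0≤1-∑w : NonNegative (1ᴿ -ᴿ sumᴿ w)
  0≤1-∑w = nonNegative-resp (begin
    weight φ zero                            ≈⟨ solve 2 (λ a b → a := a :+ b :- b) ≈ᴿ-refl (weight φ zero) (sumᴿ w) ⟩
    weight φ zero +ᴿ sumᴿ w -ᴿ sumᴿ w        ≈⟨ +ᴿ-cong ∥φ∥²≈1 ≈ᴿ-refl ⟩
    1ᴿ -ᴿ sumᴿ w                             ∎) (weight-nonNegative φ zero)

  ∥final∥²≈1 : ∀ x → normSq (finalState x) ≈ᴿ 1ᴿ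
  ∥final∥²≈1 x = begin
    normSq (U₁ ▷ oracle x φ)    ≈⟨ normSq-unitary U₁ U₁-unitary (oracle x φ) ⟩
    normSq (oracle x φ)         ≈⟨ normSq-oracle x φ ⟩
    normSq φ                    ≈⟨ ∥φ∥²≈1 ⟩
    1ᴿ                          ∎

  conflict⇒½ : ∀ {x y} → Conflict f x y → hamming w x y ≈ᴿ fromℚ ½
  conflict⇒½ {x} {y} (x∈D , y∈D , fx≢fy) = begin
    -- Solve 1 - 2h = 0 for h.
    h                                                 ≈⟨ solve 1 (λ h → h := con ½ :* (con 1ℚ :- (con 1ℚ :- (h :+ h)))) ≈ᴿ-refl h ⟩
    fromℚ ½ *ᴿ (1ᴿ -ᴿ (1ᴿ -ᴿ (h +ᴿ h)))               ≈⟨ *ᴿ-cong ≈ᴿ-refl (+ᴿ-cong ≈ᴿ-refl (-ᴿ-cong 1-2h≈0)) ⟩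
    fromℚ ½ *ᴿ (1ᴿ -ᴿ 0ᴿ)                             ≈⟨ solve 0 (con ½ :* (con 1ℚ :- con 0ℚ) := con ½) ≈ᴿ-refl ⟩
    fromℚ ½                                           ∎
    where
    h = hamming w x y
    final-orthogonal : ⟨ finalState x ∣ finalState y ⟩ ≈ᶜ 0ᶜ
    final-orthogonal = certain-distinct⇒orthogonal P-measurement (value f x x∈D)
      (finalState x) (finalState y) (∥final∥²≈1 x) (∥final∥²≈1 y)
      (A-computes-f x x∈D)
      -- Distinct Booleans are negations of each other, so the outcome certain for y is `not` of the
      -- one certain for x.
      (subst (λ b → normSq (P b ▷ finalState y) ≈ᴿ 1ᴿ) (¬-not (≢-sym fx≢fy)) (A-computes-f y y∈D))
    1-2h≈0 : 1ᴿ -ᴿ (h +ᴿ h) ≈ᴿ 0ᴿ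
    1-2h≈0 = begin
      1ᴿ -ᴿ (h +ᴿ h)
        ≈⟨ +ᴿ-cong ∥φ∥²≈1 ≈ᴿ-refl ⟨
      normSq φ -ᴿ (h +ᴿ h)
        -- The left side is the real part of the inner product of the queried states. `U₁` preserves
        -- it, and the final states are orthogonal.
        ≈⟨ proj₁ (ℂR.trans (ℂR.sym (inner-oracle x y φ))
             (ℂR.trans (ℂR.sym (inner-isometry U₁ (proj₁ U₁-unitary) (oracle x φ) (oracle y φ)))
               final-orthogonal)) ⟩
      0ᴿ ∎

-- Multilinear interpolation

listSum : ∀ {A : Set} → (A → ℝ) → List A → ℝ
listSum h xs = List.foldr _+ᴿ_ 0ᴿ (List.map h xs)

listSum-cong : ∀ {A : Set} {g h : A → ℝ} → (∀ a → g a ≈ᴿ h a) → ∀ xs → listSum g xs ≈ᴿ listSum h xs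
listSum-cong g≈h []       = ≈ᴿ-refl
listSum-cong g≈h (x ∷ xs) = +ᴿ-cong (g≈h x) (listSum-cong g≈h xs)

listSum-++ : ∀ {A : Set} (h : A → ℝ) xs ys → listSum h (xs ++ ys) ≈ᴿ listSum h xs +ᴿ listSum h ys
listSum-++ h []       ys = ≈ᴿ-sym (+ᴿ-identityˡ _)
listSum-++ h (x ∷ xs) ys = ≈ᴿ-trans (+ᴿ-cong ≈ᴿ-refl (listSum-++ h xs ys)) (≈ᴿ-sym (+ᴿ-assoc _ _ _))

listSum-map : ∀ {A B : Set} (h : B → ℝ) (k : A → B) xs → listSum h (List.map k xs) ≈ᴿ listSum (h ∘ k) xs
listSum-map h k []       = ≈ᴿ-refl
listSum-map h k (x ∷ xs) = +ᴿ-cong ≈ᴿ-refl (listSum-map h k xs)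

listSum-*ˡ : ∀ {A : Set} c (h : A → ℝ) xs → listSum (λ a → c *ᴿ h a) xs ≈ᴿ c *ᴿ listSum h xs
listSum-*ˡ c h []       = ≈ᴿ-sym (ℝR.zeroʳ c)
listSum-*ˡ c h (x ∷ xs) = ≈ᴿ-trans (+ᴿ-cong ≈ᴿ-refl (listSum-*ˡ c h xs)) (≈ᴿ-sym (*ᴿ-distribˡ c (h x) _))

-- Group the monomials by whether they contain the first variable: p = p₀ + x₁ p₁. `cube` lists the
-- two groups one after the other.
eval-∷ : ∀ {n} (p : MultilinearPoly (suc n)) b x →
  eval p (b ∷ x) ≈ᴿ eval (p ∘ (false ∷_)) x +ᴿ bit b *ᴿ eval (p ∘ (true ∷_)) x
eval-∷ {n} p b x = begin
  listSum term (List.map (false ∷_) (cube n) ++ List.map (true ∷_) (cube n))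
    ≈⟨ listSum-++ term (List.map (false ∷_) (cube n)) (List.map (true ∷_) (cube n)) ⟩
  listSum term (List.map (false ∷_) (cube n)) +ᴿ listSum term (List.map (true ∷_) (cube n))
    ≈⟨ +ᴿ-cong (listSum-map term (false ∷_) (cube n)) (listSum-map term (true ∷_) (cube n)) ⟩
  listSum (term ∘ (false ∷_)) (cube n) +ᴿ listSum (term ∘ (true ∷_)) (cube n)
    ≈⟨ +ᴿ-cong
         (listSum-cong (λ S → *ᴿ-cong ≈ᴿ-refl (*ᴿ-identityˡ (monomial S x))) (cube n))
         (listSum-cong (λ S → solve 3 (λ c b m → c :* (b :* m) := b :* (c :* m)) ≈ᴿ-refl
            (p (true ∷ S)) (bit b) (monomial S x)) (cube n)) ⟩
  eval (p ∘ (false ∷_)) x +ᴿ listSum (λ S → bit b *ᴿ (p (true ∷ S) *ᴿ monomial S x)) (cube n)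
    ≈⟨ +ᴿ-cong ≈ᴿ-refl (listSum-*ˡ (bit b) (λ S → p (true ∷ S) *ᴿ monomial S x) (cube n)) ⟩
  eval (p ∘ (false ∷_)) x +ᴿ bit b *ᴿ eval (p ∘ (true ∷_)) x ∎
  where
  open ≈-Reasoning ℝR.setoid
  open ℝ-Solver
  term : Subset (suc n) → ℝ
  term S = p S *ᴿ monomial S (b ∷ x)

-- Möbius inversion, one variable at a time.
coefficient : ∀ {n} → (Vec Bool n → ℚ) → Subset n → ℚ
coefficient g []          = g []
coefficient g (false ∷ S) = coefficient (λ x → g (false ∷ x)) S
coefficient g (true ∷ S)  = coefficient (λ x → g (true ∷ x) -ℚ g (false ∷ x)) S

interpolate : ∀ {n} → (Vec Bool n → ℚ) → MultilinearPoly n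
interpolate g S = fromℚ (coefficient g S)

-- Induction on the variables through g(b, x) = g(0, x) + b (g(1, x) - g(0, x)), which holds for b =
-- 0 and b = 1.
eval-interpolate : ∀ {n} (g : Vec Bool n → ℚ) x → eval (interpolate g) x ≈ᴿ fromℚ (g x)
eval-interpolate g [] = solve 1 (λ c → c :* con 1ℚ :+ con 0ℚ := c) ≈ᴿ-refl (fromℚ (g []))
  where open ℝ-Solver
eval-interpolate g (b ∷ x) = begin
  eval (interpolate g) (b ∷ x)
    ≈⟨ eval-∷ (interpolate g) b x ⟩
  eval (interpolate g₀) x +ᴿ bit b *ᴿ eval (interpolate g₁) x
    ≈⟨ +ᴿ-cong (eval-interpolate g₀ x) (*ᴿ-cong ≈ᴿ-refl (eval-interpolate g₁ x)) ⟩
  fromℚ (g (false ∷ x)) +ᴿ bit b *ᴿ fromℚ (g (true ∷ x) -ℚ g (false ∷ x))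
    ≈⟨ +ᴿ-cong ≈ᴿ-refl (*ᴿ-cong ≈ᴿ-refl
         (≈ᴿ-trans (fromℚ-+ (g (true ∷ x)) (-ℚ g (false ∷ x))) (+ᴿ-cong ≈ᴿ-refl (fromℚ-neg (g (false ∷ x)))))) ⟩
  fromℚ (g (false ∷ x)) +ᴿ bit b *ᴿ (fromℚ (g (true ∷ x)) -ᴿ fromℚ (g (false ∷ x)))
    ≈⟨ cases b ⟩
  fromℚ (g (b ∷ x)) ∎
  where
  open ≈-Reasoning ℝR.setoid
  open ℝ-Solver
  g₀ = λ x → g (false ∷ x)
  g₁ = λ x → g (true ∷ x) -ℚ g (false ∷ x)
  cases : ∀ b → fromℚ (g (false ∷ x)) +ᴿ bit b *ᴿ (fromℚ (g (true ∷ x)) -ᴿ fromℚ (g (false ∷ x)))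
                ≈ᴿ fromℚ (g (b ∷ x))
  cases true  = solve 2 (λ s t → s :+ con 1ℚ :* (t :- s) := t) ≈ᴿ-refl (fromℚ (g (false ∷ x))) (fromℚ (g (true ∷ x)))
  cases false = solve 2 (λ s t → s :+ con 0ℚ :* (t :- s) := s) ≈ᴿ-refl (fromℚ (g (false ∷ x))) (fromℚ (g (true ∷ x)))

coefficient-zero : ∀ {n} (g : Vec Bool n → ℚ) → (∀ x → g x ≡ 0ℚ) → ∀ S → coefficient g S ≡ 0ℚ
coefficient-zero g g≡0 []          = g≡0 []
coefficient-zero g g≡0 (false ∷ S) = coefficient-zero _ (λ x → g≡0 (false ∷ x)) S
coefficient-zero g g≡0 (true ∷ S)  = coefficient-zero _ (λ x → cong₂ _-ℚ_ (g≡0 (true ∷ x)) (g≡0 (false ∷ x))) S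

flipBit : ∀ {n} → Fin n → Vec Bool n → Vec Bool n
flipBit i x = x [ i ]%= not

flipBit-involutive : ∀ {n} (i : Fin n) x → flipBit i (flipBit i x) ≡ x
flipBit-involutive zero    (b ∷ x) = cong (_∷ x) (not-involutive b)
flipBit-involutive (suc i) (b ∷ x) = cong (b ∷_) (flipBit-involutive i x)

-- At bit i, Möbius inversion takes the difference of g across the flip, which is 0. The steps at
-- earlier bits preserve the invariance.
flip-invariant⇒coefficient≡0 : ∀ {n} {i : Fin n} (g : Vec Bool n → ℚ) → (∀ x → g (flipBit i x) ≡ g x) →
  ∀ {S} → i ∈ S → coefficient g S ≡ 0ℚ
flip-invariant⇒coefficient≡0 g invariant {true ∷ S} here = coefficient-zero _
  (λ x → ≡.trans (cong (_-ℚ g (false ∷ x)) (invariant (false ∷ x))) (ℚ.+-inverseʳ (g (false ∷ x)))) S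
flip-invariant⇒coefficient≡0 g invariant {false ∷ S} (there i∈S) =
  flip-invariant⇒coefficient≡0 _ (λ x → invariant (false ∷ x)) i∈S
flip-invariant⇒coefficient≡0 g invariant {true ∷ S} (there i∈S) =
  flip-invariant⇒coefficient≡0 _ (λ x → cong₂ _-ℚ_ (invariant (true ∷ x)) (invariant (false ∷ x))) i∈S

occurs? : ∀ {n} (g : Vec Bool n → ℚ) i → Dec (Occurs (interpolate g) i)
occurs? g i = anySubset? λ S → (i ∈? S) ×-dec ¬? (fromℚ≈0? (coefficient g S))
  where
  fromℚ≈0? : ∀ q → Dec (fromℚ q ≈ᴿ 0ᴿ)
  fromℚ≈0? q = map′ (λ { ≡.refl → ≈ᴿ-refl }) fromℚ≈0⇒≡0 (q ℚ.≟ 0ℚ)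

-- Decidability of occurrence turns the occurring variables into a subset V. If V had n elements it
-- would be full and contain i.
interpolate-numVars : ∀ {n} (g : Vec Bool n → ℚ) i → ¬ Occurs (interpolate g) i →
  ∃[ k ] (NumVars (interpolate g) k × k ℕ.< n)
interpolate-numVars {n} g i ¬i-occurs = ∣ V ∣ , (V , (λ j → mk⇔ (∈V⇒occurs j) (occurs⇒∈V j)) , ≡.refl)
  , ℕ.≤∧≢⇒< (∣p∣≤n V) λ ∣V∣≡n →
      ¬i-occurs (∈V⇒occurs i (subst (i ∈_) (≡.sym (∣p∣≡n⇒p≡⊤ ∣V∣≡n)) ∈⊤))
  where
  V : Subset n
  V = tabulate (λ j → does (occurs? g j))
  lookup-V : ∀ j → lookup V j ≡ does (occurs? g j)
  lookup-V = lookup∘tabulate (λ j → does (occurs? g j))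
  ∈V⇒occurs : ∀ j → j ∈ V → Occurs (interpolate g) j
  ∈V⇒occurs j j∈V with occurs? g j | ≡.trans (≡.sym (lookup-V j)) ([]=⇒lookup j∈V)
  ... | yes j-occurs | _ = j-occurs
  occurs⇒∈V : ∀ j → Occurs (interpolate g) j → j ∈ V
  occurs⇒∈V j j-occurs = lookup⇒[]= j V (≡.trans (lookup-V j) (dec-true (occurs? g j) j-occurs))

-- Sensitivity to a single bit

conflict? : ∀ {n} (f : PartialBoolFun n) x y → Dec (Conflict f x y)
conflict? f x y with T? (domain f x) | T? (domain f y)
... | no x∉D | _ = no λ (x∈D , _) → x∉D x∈D
... | yes _ | no y∉D = no λ (_ , y∈D , _) → y∉D y∈D
... | yes x∈D | yes y∈D = map′
  (λ fx≢fy → x∈D , y∈D , fx≢fy)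
  (λ (x∈D′ , y∈D′ , fx≢fy) → subst₂ (λ p q → value f x p ≢ value f y q) (T-irrelevant x∈D′ x∈D) (T-irrelevant y∈D′ y∈D) fx≢fy)
  (¬? (value f x x∈D Bool.≟ value f y y∈D))

Sensitive : ∀ {n} → PartialBoolFun n → Fin n → Set
Sensitive f i = ∃[ x ] Conflict f x (flipBit i x)

sensitive? : ∀ {n} (f : PartialBoolFun n) i → Dec (Sensitive f i)
-- Inputs and subsets of the bits are both Boolean vectors, so a search over subsets is a search
-- over inputs.
sensitive? f i = anySubset? (λ x → conflict? f x (flipBit i x))

-- The extension of f by `false` outside its domain. The helper abstracts `domain f x` so that, once
-- it is `true`, the membership proof is trivial.
accepts : ∀ {n} → PartialBoolFun n → Vec Bool n → Bool
accepts f x = go (domain f x) (value f x)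
  where
  go : ∀ d → (T d → Bool) → Bool
  go true  v = v _
  go false v = false

accepts-value : ∀ {n} (f : PartialBoolFun n) x (x∈D : T (domain f x)) → accepts f x ≡ value f x x∈D
accepts-value f x x∈D with domain f x | value f x
accepts-value f x _ | true | v = ≡.refl

accepts⇒∈D : ∀ {n} (f : PartialBoolFun n) x → accepts f x ≡ true → T (domain f x)
accepts⇒∈D f x fx≡true with domain f x | value f x
... | true | v = _

-- If f is insensitive to bit i, this is a total extension of f that ignores bit i.
flipClosure : ∀ {n} → PartialBoolFun n → Fin n → Vec Bool n → Bool
flipClosure f i x = accepts f x ∨ accepts f (flipBit i x)

flipClosure-invariant : ∀ {n} (f : PartialBoolFun n) i x → flipClosure f i (flipBit i x) ≡ flipClosure f i x
flipClosure-invariant f i x = ≡.trans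
  (cong (λ y → accepts f (flipBit i x) ∨ accepts f y) (flipBit-involutive i x))
  (∨-comm (accepts f (flipBit i x)) (accepts f x))

-- The disjunction could only go wrong where f x is `false` and the flipped input is accepted. That
-- input then lies in the domain and conflicts with x across bit i.
flipClosure-extends : ∀ {n} (f : PartialBoolFun n) i → ¬ Sensitive f i →
  ∀ x (x∈D : T (domain f x)) → flipClosure f i x ≡ value f x x∈D
flipClosure-extends f i insensitive x x∈D =
  ≡.trans (absorb (accepts f x) (accepts f (flipBit i x)) ≡.refl ≡.refl) (accepts-value f x x∈D)
  where
  absorb : ∀ a b → accepts f x ≡ a → accepts f (flipBit i x) ≡ b → a ∨ b ≡ a
  absorb true  b     _  _  = ≡.refl
  absorb false false _  _  = ≡.refl
  absorb false true  fx≡false fy≡true = contradiction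
    (x , x∈D , y∈D , λ fx≡fy → contradiction
      (≡.trans (≡.sym fx≡false) (≡.trans (accepts-value f x x∈D) (≡.trans fx≡fy
        (≡.trans (≡.sym (accepts-value f (flipBit i x) y∈D)) fy≡true)))) λ ())
    insensitive
    where y∈D = accepts⇒∈D f (flipBit i x) fy≡true

indicator : Bool → ℚ
indicator b = if b then 1ℚ else 0ℚ

dependsOnAllBits⇒sensitive : ∀ {n} {f : PartialBoolFun n} → DependsOnBits f n → ∀ i → Sensitive f i
dependsOnAllBits⇒sensitive {n} {f} (_ , minimal) i with sensitive? f i
... | yes sensitive = sensitive
... | no insensitive = contradiction (minimal (interpolate g) k represents numVars) (ℕ.<⇒≱ k<n)
  where
  g : Vec Bool n → ℚ
  -- Interpolating this total extension gives a polynomial for f in which variable i does not occur.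
  g x = indicator (flipClosure f i x)
  ¬i-occurs : ¬ Occurs (interpolate g) i
  ¬i-occurs (S , i∈S , cS≉0) = cS≉0 (≈ᴿ-reflexive (cong fromℚ
    (flip-invariant⇒coefficient≡0 g (λ x → cong indicator (flipClosure-invariant f i x)) i∈S)))
  few = interpolate-numVars g i ¬i-occurs
  k = proj₁ few
  numVars = proj₁ (proj₂ few)
  k<n = proj₂ (proj₂ few)
  fromℚ-indicator : ∀ b → fromℚ (indicator b) ≈ᴿ bit b
  fromℚ-indicator true  = ≈ᴿ-refl
  fromℚ-indicator false = ≈ᴿ-refl
  represents : Represents (interpolate g) f
  represents x x∈D = ≈ᴿ-trans (eval-interpolate g x)
    (subst (λ b → fromℚ (g x) ≈ᴿ bit b) (flipClosure-extends f i insensitive x x∈D)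
      (fromℚ-indicator (flipClosure f i x)))

-- Weights halved by all conflicts

xor-not-self : ∀ b → b xor not b ≡ true
xor-not-self b = ≡.trans (≡.sym (not-distribʳ-xor b b)) (cong not (xor-same b))

hamming-flipBit : ∀ {n} (w : Fin n → ℝ) x i → hamming w x (flipBit i x) ≈ᴿ w i
hamming-flipBit w (b ∷ x) zero rewrite xor-not-self b =
  ≈ᴿ-trans (+ᴿ-cong ≈ᴿ-refl (hamming-self (λ i → w (suc i)) x)) (+ᴿ-identityʳ (w zero))
hamming-flipBit w (b ∷ x) (suc i) rewrite xor-same b =
  ≈ᴿ-trans (+ᴿ-identityˡ _) (hamming-flipBit (λ i → w (suc i)) x i)

conflict-sym : ∀ {n} {f : PartialBoolFun n} {x y} → Conflict f x y → Conflict f y x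
conflict-sym (x∈D , y∈D , fx≢fy) = y∈D , x∈D , ≢-sym fx≢fy

-- Adding the weights beyond the third back to 1 - ∑ w keeps it nonnegative, yet leaves 1 - 3/2.
three-halves≰1 : ∀ {n} (w : Fin (3 ℕ.+ n) → ℝ) → (∀ i → NonNegative (w i)) → (∀ i → w i ≈ᴿ fromℚ ½) →
  ¬ NonNegative (1ᴿ -ᴿ sumᴿ w)
three-halves≰1 w 0≤w w≈½ 0≤1-∑w = contradiction
  (nonNegative-fromℚ⇒0≤ (nonNegative-resp -½ (nonNegative-+ 0≤1-∑w (sumᴿ-nonNegative (λ i → 0≤w (suc (suc (suc i))))))))
  (λ { (ℚ.*≤* ()) })
  where
  open ≈-Reasoning ℝR.setoid
  open ℝ-Solver
  r = sumᴿ (λ i → w (suc (suc (suc i))))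
  -½ : 1ᴿ -ᴿ sumᴿ w +ᴿ r ≈ᴿ fromℚ (-ℚ ½)
  -½ = begin
    1ᴿ -ᴿ (w 0F +ᴿ (w 1F +ᴿ (w 2F +ᴿ r))) +ᴿ r
      ≈⟨ +ᴿ-cong (+ᴿ-cong ≈ᴿ-refl (-ᴿ-cong
           (+ᴿ-cong (w≈½ 0F) (+ᴿ-cong (w≈½ 1F) (+ᴿ-cong (w≈½ 2F) ≈ᴿ-refl))))) ≈ᴿ-refl ⟩
    1ᴿ -ᴿ (fromℚ ½ +ᴿ (fromℚ ½ +ᴿ (fromℚ ½ +ᴿ r))) +ᴿ r
      ≈⟨ solve 1 (λ r → con 1ℚ :- (con ½ :+ (con ½ :+ (con ½ :+ r))) :+ r := con (-ℚ ½)) ≈ᴿ-refl r ⟩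
    fromℚ (-ℚ ½) ∎

-- Classification for one and two bits

≡⊎≡not : ∀ b c → c ≡ b ⊎ c ≡ not b
≡⊎≡not b c with c Bool.≟ b
... | yes c≡b = inj₁ c≡b
... | no c≢b  = inj₂ (¬-not c≢b)

-- Relative to the base point u, the functions f and g change together, so their xor is constant on
-- the domain and its value at u decides between g and its negation.
agrees-up-to-negation : ∀ {n} (f : PartialBoolFun n) (g : Vec Bool n → Bool) {u} (u∈D : T (domain f u)) →
  (∀ x (x∈D : T (domain f x)) →
    (value f x x∈D ≡ value f u u∈D × g x ≡ g u) ⊎ (value f x x∈D ≢ value f u u∈D × g x ≡ not (g u))) →
  AgreesOnDomain f g ⊎ AgreesOnDomain f (λ x → true xor g x)
agrees-up-to-negation f g {u} u∈D aligned with value f u u∈D Bool.≟ g u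
... | yes fu≡gu = inj₁ λ x x∈D → agree (aligned x x∈D)
  where
  agree : ∀ {a b} → (a ≡ value f u u∈D × b ≡ g u) ⊎ (a ≢ value f u u∈D × b ≡ not (g u)) → a ≡ b
  agree (inj₁ (≡.refl , ≡.refl)) = fu≡gu
  agree (inj₂ (a≢fu , ≡.refl))   = ≡.trans (¬-not a≢fu) (cong not fu≡gu)
... | no fu≢gu = inj₂ λ x x∈D → disagree (aligned x x∈D)
  where
  disagree : ∀ {a b} → (a ≡ value f u u∈D × b ≡ g u) ⊎ (a ≢ value f u u∈D × b ≡ not (g u)) → a ≡ not b
  disagree (inj₁ (≡.refl , ≡.refl)) = ¬-not fu≢gu
  disagree (inj₂ (a≢fu , ≡.refl))   = ≡.trans (¬-not a≢fu) (cong not (¬-not fu≢gu))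

value-irrelevant : ∀ {n} (f : PartialBoolFun n) {x} (p q : T (domain f x)) → value f x p ≡ value f x q
value-irrelevant f {x} p q = cong (value f x) (T-irrelevant p q)

conflict⇒≢ : ∀ {n} {f : PartialBoolFun n} {x y} → Conflict f x y →
  (x∈D : T (domain f x)) (y∈D : T (domain f y)) → value f y y∈D ≢ value f x x∈D
conflict⇒≢ {f = f} (x∈D , y∈D , fx≢fy) x∈D′ y∈D′ fy≡fx = fx≢fy
  (≡.trans (value-irrelevant f x∈D x∈D′) (≡.trans (≡.sym fy≡fx) (value-irrelevant f y∈D′ y∈D)))

sensitive⇒oneBitCase : (f : PartialBoolFun 1) → Sensitive f 0F → OneBitCase f
sensitive⇒oneBitCase f (b ∷ [] , conflict@(b∈D , b̄∈D , _)) = total , agrees-up-to-negation f x₁ b∈D aligned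
  where
  total : ∀ x → T (domain f x)
  total (c ∷ []) with ≡⊎≡not b c
  ... | inj₁ ≡.refl = b∈D
  ... | inj₂ ≡.refl = b̄∈D
  aligned : ∀ x (x∈D : T (domain f x)) →
    (value f x x∈D ≡ value f (b ∷ []) b∈D × x₁ x ≡ b) ⊎ (value f x x∈D ≢ value f (b ∷ []) b∈D × x₁ x ≡ not b)
  aligned (c ∷ []) x∈D with ≡⊎≡not b c
  ... | inj₁ ≡.refl = inj₁ (value-irrelevant f x∈D b∈D , ≡.refl)
  ... | inj₂ ≡.refl = inj₂ (conflict⇒≢ {f = f} conflict b∈D x∈D , ≡.refl)

count : Bool → ℕ
count b = if b then 1 else 0

-- It turns `domainSize` into a sum with one summand per input, which computes once the four domain
-- bits are abstracted.
length-filterᵇ : ∀ {A : Set} (p : A → Bool) xs → List.length (List.filterᵇ p xs) ≡ ListAction.sum (List.map (count ∘ p) xs)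
length-filterᵇ p []       = ≡.refl
length-filterᵇ p (x ∷ xs) with p x
... | true  = cong suc (length-filterᵇ p xs)
... | false = length-filterᵇ p xs

domainSize-3⊎4 : ∀ (f : PartialBoolFun 2) a b → T (domain f (a ∷ b ∷ [])) →
  T (domain f (not a ∷ b ∷ [])) → T (domain f (a ∷ not b ∷ [])) → domainSize f ≡ 3 ⊎ domainSize f ≡ 4
domainSize-3⊎4 f a b p q r rewrite length-filterᵇ (domain f) (cube 2) = sizes a b p q r
  where
  sizes : ∀ a b → T (domain f (a ∷ b ∷ [])) → T (domain f (not a ∷ b ∷ [])) → T (domain f (a ∷ not b ∷ [])) →
    ListAction.sum (List.map (count ∘ domain f) (cube 2)) ≡ 3 ⊎ ListAction.sum (List.map (count ∘ domain f) (cube 2)) ≡ 4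
  sizes false false p q r
    with domain f (false ∷ false ∷ []) | domain f (false ∷ true ∷ []) | domain f (true ∷ false ∷ []) | domain f (true ∷ true ∷ [])
  ... | true | true | true | false = inj₁ ≡.refl
  ... | true | true | true | true = inj₂ ≡.refl
  sizes false true p q r
    with domain f (false ∷ false ∷ []) | domain f (false ∷ true ∷ []) | domain f (true ∷ false ∷ []) | domain f (true ∷ true ∷ [])
  ... | true | true | false | true = inj₁ ≡.refl
  ... | true | true | true  | true = inj₂ ≡.refl
  sizes true false p q r
    with domain f (false ∷ false ∷ []) | domain f (false ∷ true ∷ []) | domain f (true ∷ false ∷ []) | domain f (true ∷ true ∷ [])
  ... | true | false | true | true = inj₁ ≡.refl
  ... | true | true  | true | true = inj₂ ≡.refl
  sizes true true p q r
    with domain f (false ∷ false ∷ []) | domain f (false ∷ true ∷ []) | domain f (true ∷ false ∷ []) | domain f (true ∷ true ∷ [])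
  ... | false | true | true | true = inj₁ ≡.refl
  ... | true  | true | true | true = inj₂ ≡.refl

xor-not-not : ∀ a b → not a xor not b ≡ a xor b
xor-not-not true  b = ≡.refl
xor-not-not false b = not-involutive b

-- Seen from the corner (a, b), f changes at both neighbours and does not change at the antipode, if
-- that lies in the domain. The parity behaves in the same way.
twoBitCase : (f : PartialBoolFun 2) → ∀ a b →
  Conflict f (a ∷ b ∷ []) (not a ∷ b ∷ []) → Conflict f (a ∷ b ∷ []) (a ∷ not b ∷ []) →
  ¬ Conflict f (a ∷ b ∷ []) (not a ∷ not b ∷ []) → TwoBitCase f
twoBitCase f a b c₁@(u∈D , v∈D , _) c₂@(_ , w∈D , _) ¬c₁₂ =
  domainSize-3⊎4 f a b u∈D v∈D w∈D , agrees-up-to-negation f (λ x → x₁ x xor x₂ x) u∈D aligned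
  where
  u = a ∷ b ∷ []
  aligned : ∀ x (x∈D : T (domain f x)) →
    (value f x x∈D ≡ value f u u∈D × x₁ x xor x₂ x ≡ a xor b) ⊎
    (value f x x∈D ≢ value f u u∈D × x₁ x xor x₂ x ≡ not (a xor b))
  aligned (c ∷ d ∷ []) x∈D with ≡⊎≡not a c | ≡⊎≡not b d
  ... | inj₁ ≡.refl | inj₁ ≡.refl = inj₁ (value-irrelevant f x∈D u∈D , ≡.refl)
  ... | inj₂ ≡.refl | inj₁ ≡.refl = inj₂ (conflict⇒≢ {f = f} c₁ u∈D x∈D , ≡.sym (not-distribˡ-xor a b))
  ... | inj₁ ≡.refl | inj₂ ≡.refl = inj₂ (conflict⇒≢ {f = f} c₂ u∈D x∈D , ≡.sym (not-distribʳ-xor a b))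
  ... | inj₂ ≡.refl | inj₂ ≡.refl = inj₁
    -- The absence of a conflict only refutes inequality; decidable equality of Booleans makes it an
    -- equality.
    (decidable-stable (_ Bool.≟ _) (λ fx≢fu → ¬c₁₂ (u∈D , x∈D , ≢-sym fx≢fu)) , xor-not-not a b)

sensitive⇒weight≈½ : ∀ {n} {f : PartialBoolFun n} {w : Fin n → ℝ} →
  (∀ {x y} → Conflict f x y → hamming w x y ≈ᴿ fromℚ ½) → ∀ {i} → Sensitive f i → w i ≈ᴿ fromℚ ½
sensitive⇒weight≈½ {w = w} conflict⇒½ {i} (x , conflict) =
  ≈ᴿ-trans (≈ᴿ-sym (hamming-flipBit w x i)) (conflict⇒½ conflict)

antipodes-agree : ∀ {f : PartialBoolFun 2} → HalvingWeights f → (∀ i → Sensitive f i) →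
  ∀ a b → ¬ Conflict f (a ∷ b ∷ []) (not a ∷ not b ∷ [])
antipodes-agree {f} (w , _ , _ , conflict⇒½) sensitive a b conflict =
  contradiction (fromℚ≈0⇒≡0 ½≈0) (λ ())
  where
  open ≈-Reasoning ℝR.setoid
  open ℝ-Solver
  w≈½ : ∀ i → w i ≈ᴿ fromℚ ½
  w≈½ i = sensitive⇒weight≈½ {f = f} {w} conflict⇒½ (sensitive i)
  hamming-antipodes : hamming w (a ∷ b ∷ []) (not a ∷ not b ∷ []) ≡ w 0F +ᴿ (w 1F +ᴿ 0ᴿ)
  hamming-antipodes rewrite xor-not-self a | xor-not-self b = ≡.refl
  ½≈0 : fromℚ ½ ≈ᴿ 0ᴿ
  ½≈0 = begin
    fromℚ ½
      -- Writing ½ as 1 - ½ exposes the distance of the antipodes, which the weights make 1 and the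
      -- conflict makes ½.
      ≈⟨ solve 0 (con ½ := con ½ :+ (con ½ :+ con 0ℚ) :- con ½) ≈ᴿ-refl ⟩
    fromℚ ½ +ᴿ (fromℚ ½ +ᴿ 0ᴿ) -ᴿ fromℚ ½
      ≈⟨ +ᴿ-cong (+ᴿ-cong (w≈½ 0F) (+ᴿ-cong (w≈½ 1F) ≈ᴿ-refl)) ≈ᴿ-refl ⟨
    w 0F +ᴿ (w 1F +ᴿ 0ᴿ) -ᴿ fromℚ ½
      ≈⟨ +ᴿ-cong (≈ᴿ-trans (≈ᴿ-reflexive (≡.sym hamming-antipodes)) (conflict⇒½ conflict)) ≈ᴿ-refl ⟩
    fromℚ ½ -ᴿ fromℚ ½
      ≈⟨ -ᴿ-inverseʳ (fromℚ ½) ⟩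
    0ᴿ ∎

-- Two edges of the square in different directions share a vertex.
sensitive⇒corner : ∀ {f : PartialBoolFun 2} → Sensitive f 0F → Sensitive f 1F →
  ∃[ a ] ∃[ b ] (Conflict f (a ∷ b ∷ []) (not a ∷ b ∷ []) × Conflict f (a ∷ b ∷ []) (a ∷ not b ∷ []))
sensitive⇒corner {f} (a ∷ b ∷ [] , c₁) (a′ ∷ b′ ∷ [] , c₂) =
  -- The edge flipping the first bit has constant second bit b, the edge flipping the second has
  -- constant first bit a′; they meet at (a′, b). An edge met at its other end is reversed.
  a′ , b , turn₁ (≡⊎≡not a a′) , turn₂ (≡⊎≡not b′ b)
  where
  turn₁ : a′ ≡ a ⊎ a′ ≡ not a → Conflict f (a′ ∷ b ∷ []) (not a′ ∷ b ∷ [])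
  turn₁ (inj₁ ≡.refl) = c₁
  turn₁ (inj₂ ≡.refl) = subst (λ c → Conflict f (not a ∷ b ∷ []) (c ∷ b ∷ [])) (≡.sym (not-involutive a))
    (conflict-sym {f = f} c₁)
  turn₂ : b ≡ b′ ⊎ b ≡ not b′ → Conflict f (a′ ∷ b ∷ []) (a′ ∷ not b ∷ [])
  turn₂ (inj₁ ≡.refl) = c₂
  turn₂ (inj₂ ≡.refl) = subst (λ c → Conflict f (a′ ∷ not b′ ∷ []) (a′ ∷ c ∷ [])) (≡.sym (not-involutive b′))
    (conflict-sym {f = f} c₂)

no-three-sensitive-bits : ∀ {n} {f : PartialBoolFun (3 ℕ.+ n)} → HalvingWeights f → ¬ (∀ i → Sensitive f i)
no-three-sensitive-bits {f = f} (w , 0≤w , 0≤1-∑w , conflict⇒½) sensitive = three-halves≰1 w 0≤w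
  (λ i → sensitive⇒weight≈½ {f = f} {w} conflict⇒½ (sensitive i)) 0≤1-∑w

sensitive⇒twoBitCase : ∀ {f : PartialBoolFun 2} → HalvingWeights f → (∀ i → Sensitive f i) → TwoBitCase f
sensitive⇒twoBitCase {f} weights sensitive =
  let a , b , c₁ , c₂ = sensitive⇒corner {f} (sensitive 0F) (sensitive 1F)
  in twoBitCase f a b c₁ c₂ (antipodes-agree {f} weights sensitive a b)

exact⇒characterised : ∀ n → 1 ℕ.≤ n → (f : PartialBoolFun n) → DependsOnBits f n → ExactlyOneQueryComputable f →
  (Σ[ eq ∈ n ≡ 1 ] OneBitCase (subst PartialBoolFun eq f)) ⊎
  (Σ[ eq ∈ n ≡ 2 ] TwoBitCase (subst PartialBoolFun eq f))
exact⇒characterised 1 _ f depends exact =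
  inj₁ (≡.refl , sensitive⇒oneBitCase f (dependsOnAllBits⇒sensitive {f = f} depends 0F))
exact⇒characterised 2 _ f depends exact =
  inj₂ (≡.refl , sensitive⇒twoBitCase {f} (exact⇒halvingWeights {f = f} exact) (dependsOnAllBits⇒sensitive {f = f} depends))
exact⇒characterised (suc (suc (suc n))) _ f depends exact = contradiction
  (dependsOnAllBits⇒sensitive {f = f} depends)
  (no-three-sensitive-bits {f = f} (exact⇒halvingWeights {f = f} exact))

-- Algorithms for the parity

xor-cancelˡ : ∀ a b → a xor (a xor b) ≡ b
xor-cancelˡ true  b = not-involutive b
xor-cancelˡ false b = ≡.refl

-- The algorithm prepares ψ, queries, and measures whether the state is still along ψ.
module RankOneAlgorithm {n m : ℕ} (ψ : State n m) (∥ψ∥²≈1 : normSq ψ ≈ᴿ 1ᴿ) (along : Bool) where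
  open ℂLinear n m using (⟨_∣_⟩; _≈ᵛ_; inner-cong; I-▹; ▹-congˡ; I-isometry; I-coisometry; module RankOne)
  open RankOne ψ (ℂR.trans (inner-self ψ) (∥ψ∥²≈1 , ≈ᴿ-refl))

  -- Outcome `along` is attached to the projection onto ψ, the other outcome to its complement.
  -- Choosing `along` selects the parity or its negation.
  measure : Bool → Operator n m
  measure b = if along xor b then complement else projector

  measure-isProjective : IsProjectiveMeasurement measure
  measure-isProjective = record
    { selfAdjoint = λ b → selfAdjoint (along xor b)
    ; idempotent  = λ b → idempotent (along xor b)
    ; orthogonal  = orthogonal along
    ; complete    = complete along }
    where
    test : Bool → Operator n m
    test c = if c then complement else projector
    selfAdjoint : ∀ c → test c † ≈ᴼ test c
    selfAdjoint true  = complement-selfAdjoint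
    selfAdjoint false = projector-selfAdjoint
    idempotent : ∀ c → test c · test c ≈ᴼ test c
    idempotent true  = complement-idempotent
    idempotent false = projector-idempotent
    orthogonal : ∀ a b → test (a xor b) · test (a xor not b) ≈ᴼ 𝟘
    orthogonal true  true  = orthogonalʳ
    orthogonal true  false = orthogonalˡ
    orthogonal false true  = orthogonalˡ
    orthogonal false false = orthogonalʳ
    complete : ∀ a → test (a xor false) +ᴼ test (a xor true) ≈ᴼ 𝟙
    complete false = complement-complete
    complete true i j = ℂR.trans (ℂR.+-comm (complement i j) (projector i j)) (complement-complete i j)

  algorithm : OneQueryAlgorithm n
  algorithm = record
    { m = m ; ψ₀ = ψ ; U₀ = 𝟙 ; U₁ = 𝟙 ; P = measure
    ; ψ₀-normalised = ∥ψ∥²≈1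
    ; U₀-unitary = I-isometry , I-coisometry
    ; U₁-unitary = I-isometry , I-coisometry
    ; P-measurement = measure-isProjective }

  open OneQueryAlgorithm algorithm using (finalState; probability)

  final≈oracle : ∀ x → finalState x ≈ᵛ oracle x ψ
  final≈oracle x a = ℂR.trans (I-▹ (oracle x (𝟙 ▷ ψ)) a) (oracle-cong a)
    where
    oracle-cong : oracle x (𝟙 ▷ ψ) ≈ᵛ oracle x ψ
    oracle-cong (i , j) = ℂR.*-congˡ {phase x i} (I-▹ ψ (i , j))

  fixed⇒certain : ∀ x b → measure b ▷ oracle x ψ ≈ᵛ oracle x ψ → probability x b ≈ᴿ 1ᴿ
  fixed⇒certain x b fixed = begin
    normSq (measure b ▷ finalState x)    ≈⟨ normSq-cong {u = measure b ▷ finalState x} {measure b ▷ oracle x ψ} (▹-congˡ {U = measure b} (final≈oracle x)) ⟩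
    normSq (measure b ▷ oracle x ψ)      ≈⟨ normSq-cong {u = measure b ▷ oracle x ψ} {oracle x ψ} fixed ⟩
    normSq (oracle x ψ)                  ≈⟨ normSq-oracle x ψ ⟩
    normSq ψ                             ≈⟨ ∥ψ∥²≈1 ⟩
    1ᴿ                                   ∎
    where open ≈-Reasoning ℝR.setoid

  -- The outcome is written `along xor false` to match `along xor` the parity of x.
  parallel⇒certain : ∀ x c → oracle x ψ ≈ᵛ (λ a → ψ a *ᶜ c) → probability x (along xor false) ≈ᴿ 1ᴿ
  parallel⇒certain x c xψ≈ψc = fixed⇒certain x (along xor false)
    (subst (λ b → (if b then complement else projector) ▷ oracle x ψ ≈ᵛ oracle x ψ) (≡.sym (xor-cancelˡ along false))
      (projector-fixes c {oracle x ψ} xψ≈ψc))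

  orthogonal⇒certain : ∀ x → ⟨ ψ ∣ oracle x ψ ⟩ ≈ᶜ 0ᶜ → probability x (along xor true) ≈ᴿ 1ᴿ
  orthogonal⇒certain x ⟨ψ∣xψ⟩≈0 = fixed⇒certain x (along xor true)
    (subst (λ b → (if b then complement else projector) ▷ oracle x ψ ≈ᵛ oracle x ψ) (≡.sym (xor-cancelˡ along true))
      (▹≈0⇒complement-fixes {oracle x ψ} (projector-annihilates {oracle x ψ} ⟨ψ∣xψ⟩≈0)))

  -- Querying the all-zero input leaves ψ unchanged, so ⟨ψ∣O ψ⟩ is an inner product of two queried
  -- states and equals 1 - 2h, here 0.
  half⇒certain : ∀ x → hamming (λ i → weight ψ (suc i)) (replicate n false) x ≈ᴿ fromℚ ½ →
    probability x (along xor true) ≈ᴿ 1ᴿ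
  half⇒certain x h≈½ = orthogonal⇒certain x (begin
    ⟨ ψ ∣ oracle x ψ ⟩
      ≈⟨ inner-cong {ψ} {oracle (replicate n false) ψ} {oracle x ψ} {oracle x ψ} zero-phase (λ _ → ℂR.refl) ⟩
    ⟨ oracle (replicate n false) ψ ∣ oracle x ψ ⟩
      ≈⟨ inner-oracle (replicate n false) x ψ ⟩
    ι (normSq ψ -ᴿ (h +ᴿ h))
      ≈⟨ +ᴿ-cong ∥ψ∥²≈1 (-ᴿ-cong (+ᴿ-cong h≈½ h≈½)) , ≈ᴿ-refl ⟩
    ι (1ᴿ -ᴿ (fromℚ ½ +ᴿ fromℚ ½))
      ≈⟨ solve 0 (con 1ℚ :- (con ½ :+ con ½) := con 0ℚ) ≈ᴿ-refl , ≈ᴿ-refl ⟩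
    0ᶜ ∎)
    where
    open ≈-Reasoning ℂR.setoid
    open ℝ-Solver
    h = hamming (λ i → weight ψ (suc i)) (replicate n false) x
    zero-phase : ψ ≈ᵛ oracle (replicate n false) ψ
    zero-phase (zero  , j) = ℂR.sym (ℂR.*-identityˡ (ψ (zero , j)))
    zero-phase (suc i , j) rewrite lookup-replicate i false = ℂR.sym (ℂR.*-identityˡ (ψ (suc i , j)))

-- Amplitude 1/√2 on a query position is realised by amplitude ½ on each of two work-space states.
ψ₁ : State 1 2
ψ₁ _ = ι (fromℚ ½)

ψ₂ : State 2 2
ψ₂ (zero  , _) = 0ᶜ
ψ₂ (suc _ , _) = ι (fromℚ ½)

module _ where
  open ℝ-Solver

  quarter : ∀ {k} → Polynomial k
  quarter = con ½ :* con ½ :+ con 0ℚ :* con 0ℚ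

  half : ∀ {k} → Polynomial k
  half = quarter :+ (quarter :+ con 0ℚ)

  ∥ψ₁∥²≈1 : normSq ψ₁ ≈ᴿ 1ᴿ
  ∥ψ₁∥²≈1 = solve 0 (half :+ (half :+ con 0ℚ) := con 1ℚ) ≈ᴿ-refl

  ∥ψ₂∥²≈1 : normSq ψ₂ ≈ᴿ 1ᴿ
  ∥ψ₂∥²≈1 = solve 0 (nought :+ (nought :+ con 0ℚ) :+ (half :+ (half :+ con 0ℚ)) := con 1ℚ) ≈ᴿ-refl
    where
    nought : Polynomial 0
    nought = con 0ℚ :* con 0ℚ :+ con 0ℚ :* con 0ℚ

  module OneBit (along : Bool) where
    open RankOneAlgorithm ψ₁ ∥ψ₁∥²≈1 along public
    open OneQueryAlgorithm algorithm using (probability)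

    certain : ∀ x → probability x (along xor x₁ x) ≈ᴿ 1ᴿ
    certain x@(false ∷ []) = parallel⇒certain x 1ᶜ λ where
        (0F , j) → ℂR.*-comm 1ᶜ (ψ₁ (0F , j))
        (1F , j) → ℂR.*-comm 1ᶜ (ψ₁ (1F , j))
    -- The distance from the zero input is the weight of the single bit: two work-space amplitudes
    -- with square ¼ each.
    certain x@(true ∷ []) = half⇒certain x (solve 0 (half :+ con 0ℚ := con ½) ≈ᴿ-refl)

  module TwoBit (along : Bool) where
    open RankOneAlgorithm ψ₂ ∥ψ₂∥²≈1 along public
    open OneQueryAlgorithm algorithm using (probability)

    certain : ∀ x → probability x (along xor (x₁ x xor x₂ x)) ≈ᴿ 1ᴿ
    certain x@(false ∷ false ∷ []) = parallel⇒certain x 1ᶜ λ where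
        (0F , j) → ℂR.*-comm 1ᶜ (ψ₂ (0F , j))
        (1F , j) → ℂR.*-comm 1ᶜ (ψ₂ (1F , j))
        (2F , j) → ℂR.*-comm 1ᶜ (ψ₂ (2F , j))
    -- Both bit positions change sign, so the state becomes -ψ; at position 0 the phase stays 1, but
    -- the amplitude is 0.
    certain x@(true ∷ true ∷ []) = parallel⇒certain x (-ᶜ 1ᶜ) λ where
        (0F , j) → ℂR.trans (ℂR.zeroʳ 1ᶜ) (ℂR.sym (ℂR.zeroˡ (-ᶜ 1ᶜ)))
        (1F , j) → ℂR.*-comm (-ᶜ 1ᶜ) (ψ₂ (1F , j))
        (2F , j) → ℂR.*-comm (-ᶜ 1ᶜ) (ψ₂ (2F , j))
    certain x@(false ∷ true ∷ []) = half⇒certain x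
      (solve 0 (con 0ℚ :+ (half :+ con 0ℚ) := con ½) ≈ᴿ-refl)
    certain x@(true ∷ false ∷ []) = half⇒certain x
      (solve 0 (half :+ (con 0ℚ :+ con 0ℚ) := con ½) ≈ᴿ-refl)

oneBitCase⇒exact : ∀ f → OneBitCase f → ExactlyOneQueryComputable f
-- `false xor g` reduces to `g`, so both alternatives are instances of one construction.
oneBitCase⇒exact f (_ , agrees) = [ computes false , computes true ]′ agrees
  where
  computes : ∀ b → AgreesOnDomain f (λ x → b xor x₁ x) → ExactlyOneQueryComputable f
  computes b f≡g = algorithm , λ x x∈D →
    subst (λ c → OneQueryAlgorithm.probability algorithm x c ≈ᴿ 1ᴿ) (≡.sym (f≡g x x∈D)) (certain x)
    where open OneBit b

twoBitCase⇒exact : ∀ f → TwoBitCase f → ExactlyOneQueryComputable f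
twoBitCase⇒exact f (_ , agrees) = [ computes false , computes true ]′ agrees
  where
  computes : ∀ b → AgreesOnDomain f (λ x → b xor (x₁ x xor x₂ x)) → ExactlyOneQueryComputable f
  computes b f≡g = algorithm , λ x x∈D →
    subst (λ c → OneQueryAlgorithm.probability algorithm x c ≈ᴿ 1ᴿ) (≡.sym (f≡g x x∈D)) (certain x)
    where open TwoBit b

theorem2 : ∀ (n : ℕ) → 1 ℕ.≤ n → (f : PartialBoolFun n) → DependsOnBits f n →
    ExactlyOneQueryComputable f ⇔
    ((Σ[ eq ∈ n ≡ 1 ] OneBitCase (subst PartialBoolFun eq f)) ⊎
    (Σ[ eq ∈ n ≡ 2 ] TwoBitCase (subst PartialBoolFun eq f)))
theorem2 n 1≤n f depends = mk⇔ (exact⇒characterised n 1≤n f depends) characterised⇒exact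
  where
  characterised⇒exact :
    (Σ[ eq ∈ n ≡ 1 ] OneBitCase (subst PartialBoolFun eq f)) ⊎
    (Σ[ eq ∈ n ≡ 2 ] TwoBitCase (subst PartialBoolFun eq f)) → ExactlyOneQueryComputable f
  characterised⇒exact (inj₁ (≡.refl , one)) = oneBitCase⇒exact f one
  characterised⇒exact (inj₂ (≡.refl , two)) = twoBitCase⇒exact f two
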